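{- Let $q$ be a prime power and let $m,k$ be integers with $2\le k\le\left\lfloor\frac{m+1}{2}\right\rfloor$. For every $n\in\{m,\ldots,2m-2k+1\}$ there exists a nondegenerate rank-metric intersecting $[n,k,d]_{q^m/q}$ code with $d>\frac{n}{2}$.
   Context: Support and rank: fix an $\mathbb{F}_q$-basis $\Gamma$ of $\mathbb{F}_{q^m}$. For $x=(x_1,\dots,x_n)\in\mathbb{F}_{q^m}^n$ let $\mathrm{Mat}_\Gamma(x)\in\mathbb{F}_q^{m\times n}$ be the matrix whose $j$-th column is the coordinate vector of $x_j$ in the basis $\Gamma$. The support $\sigma(x)\subseteq\mathbb{F}_q^n$ is the $\mathbb{F}_q$-row space of $\mathrm{Mat}_\Gamma(x)$, and $\mathrm{rk}(x)=\dim_{\mathbb{F}_q}\sigma(x)$; both are independent of $\Gamma$. An $[n,k,d]_{q^m/q}$ code is an $\mathbb{F}_{q^m}$-linear subspace $\mathcal{C}$ of $\mathbb{F}_{q^m}^n$ with $k=\dim_{\mathbb{F}_{q^m}}\mathcal{C}\ge 1$ and minimum distance $d=\min_{c\in\mathcal{C}\setminus\{0\}}\mathrm{rk}(c)$. The code is nondegenerate if $\sum_{c\in\mathcal{C}}\sigma(c)=\mathbb{F}_q^n$. It is rank-metric intersecting if $\sigma(c)\cap\sigma(c')\ne\{0\}$ for all $c,c'\in\mathcal{C}\setminus\{0\}$. -}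

module Defs where

open import Level using (Level; _⊔_; suc)
open import Algebra.Bundles using (Ring; CommutativeRing)
open import Algebra.Definitions using (Invertible)
open import Algebra.Definitions.RawMonoid using (sum)
open import Algebra.Module.Bundles using (LeftModule)
open import Algebra.Module.Construct.TensorUnit using (leftModule)
open import Algebra.Morphism.Structures using (IsRingHomomorphism)
open import Data.Fin.Base using (Fin)
open import Data.Nat.Base using (ℕ; _≤_; _^_)
open import Data.Nat.Primality using (Prime)
open import Data.Product.Base using (∃; ∃-syntax; Σ-syntax; _×_; _,_; proj₁; proj₂)
open import Data.Unit.Base using (tt)
open import Data.Vec.Functional using (Vector)
open import Function.Bundles using (Inverse)
open import Relation.Binary.PropositionalEquality using (_≡_; setoid)
open import Relation.Nullary.Negation using (¬_)
open import Relation.Unary using (Pred; _∈_; _⊆_; _∩_; U)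

IsPrimePower : ℕ → Set
IsPrimePower q = ∃[ p ] ∃[ e ] Prime p × 1 ≤ e × q ≡ p ^ e

record Field (c ℓ : Level) : Set (suc (c ⊔ ℓ)) where
  field
    commutativeRing : CommutativeRing c ℓ
  open CommutativeRing commutativeRing public
  field
    1≉0     : ¬ (1# ≈ 0#)
    inverse : ∀ x → ¬ (x ≈ 0#) → Invertible _≈_ 1# _*_ x

HasCardinality : ∀ {c ℓ} → Field c ℓ → ℕ → Set (c ⊔ ℓ)
HasCardinality F q = Inverse (Field.setoid F) (setoid (Fin q))

-- Linear algebra.  Over a field, a left module is a vector space; a subset of
-- it is a predicate, and a finite family of vectors is a Vector.
module Linear {r ℓr a ℓa} {R : Ring r ℓr} (M : LeftModule R a ℓa) where
  open LeftModule M
  private module R = Ring R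

  ∑ : ∀ {k} → Vector Carrierᴹ k → Carrierᴹ
  ∑ = sum +ᴹ-rawMonoid

  combination : ∀ {k} → Vector R.Carrier k → Vector Carrierᴹ k → Carrierᴹ
  combination s v = ∑ (λ i → s i *ₗ v i)

  Span : ∀ {k} → Vector Carrierᴹ k → Pred Carrierᴹ (r ⊔ ℓa)
  Span v x = ∃[ s ] combination s v ≈ᴹ x

  LinearlyIndependent : ∀ {k} → Vector Carrierᴹ k → Set (r ⊔ ℓr ⊔ ℓa)
  LinearlyIndependent v = ∀ s → combination s v ≈ᴹ 0ᴹ → ∀ i → s i R.≈ R.0#

  record IsSubspace {p} (V : Pred Carrierᴹ p) : Set (r ⊔ a ⊔ ℓa ⊔ p) where
    field
      resp      : ∀ {x y} → x ≈ᴹ y → x ∈ V → y ∈ V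
      0-closed  : 0ᴹ ∈ V
      +-closed  : ∀ {x y} → x ∈ V → y ∈ V → (x +ᴹ y) ∈ V
      *-closed  : ∀ s {x} → x ∈ V → (s *ₗ x) ∈ V

  record IsBasis {p k} (V : Pred Carrierᴹ p) (v : Vector Carrierᴹ k)
                 : Set (r ⊔ ℓr ⊔ a ⊔ ℓa ⊔ p) where
    field
      members     : ∀ i → v i ∈ V
      independent : LinearlyIndependent v
      spanning    : V ⊆ Span v

  HasDimension : ∀ {p} → Pred Carrierᴹ p → ℕ → Set (r ⊔ ℓr ⊔ a ⊔ ℓa ⊔ p)
  HasDimension V k = ∃[ v ] IsBasis {k = k} V v

  -- The sum of a possibly infinite family of subspaces: all finite sums of
  -- vectors, each taken from some member of the family.
  Sum : ∀ {i p} {I : Set i} → (I → Pred Carrierᴹ p) → Pred Carrierᴹ (i ⊔ a ⊔ ℓa ⊔ p)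
  Sum {I = I} V x =
    Σ[ t ∈ ℕ ] Σ[ index ∈ Vector I t ] Σ[ w ∈ Vector Carrierᴹ t ]
      (∀ j → w j ∈ V (index j)) × ∑ w ≈ᴹ x

coordinateSpace : ∀ {r ℓr} (R : Ring r ℓr) → ℕ → LeftModule R r ℓr
coordinateSpace R n = record
  { Carrierᴹ = Vector Carrier n
  ; _≈ᴹ_ = λ x y → ∀ i → x i ≈ y i
  ; _+ᴹ_ = λ x y i → x i + y i
  ; _*ₗ_ = λ s x i → s * x i
  ; 0ᴹ = λ _ → 0#
  ; -ᴹ_ = λ x i → - x i
  ; isLeftModule = record
    { isLeftSemimodule = record
      { +ᴹ-isCommutativeMonoid = record
        { isMonoid = record
          { isSemigroup = record
            { isMagma = record
              { isEquivalence = record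
                { refl = λ _ → refl
                ; sym = λ p i → sym (p i)
                ; trans = λ p q i → trans (p i) (q i)
                }
              ; ∙-cong = λ p q i → +-cong (p i) (q i)
              }
            ; assoc = λ x y z i → +-assoc (x i) (y i) (z i)
            }
          ; identity = (λ x i → +-identityˡ (x i)) , (λ x i → +-identityʳ (x i))
          }
        ; comm = λ x y i → +-comm (x i) (y i)
        }
      ; isPreleftSemimodule = record
        { *ₗ-cong = λ p q i → *-cong p (q i)
        ; *ₗ-zeroˡ = λ x i → zeroˡ (x i)
        ; *ₗ-distribʳ = λ x s t i → distribʳ (x i) s t
        ; *ₗ-identityˡ = λ x i → *-identityˡ (x i)
        ; *ₗ-assoc = λ s t x i → *-assoc s t (x i)
        ; *ₗ-zeroʳ = λ s i → zeroʳ s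
        ; *ₗ-distribˡ = λ s x y i → distribˡ s (x i) (y i)
        }
      }
    ; -ᴹ‿cong = λ p i → -‿cong (p i)
    ; -ᴹ‿inverse = (λ x i → -‿inverseˡ (x i)) , (λ x i → -‿inverseʳ (x i))
    }
  }
  where open Ring R

restrictScalars : ∀ {r ℓr s ℓs a ℓa} (R : Ring r ℓr) (S : Ring s ℓs)
                  (f : Ring.Carrier R → Ring.Carrier S) →
                  IsRingHomomorphism (Ring.rawRing R) (Ring.rawRing S) f →
                  LeftModule S a ℓa → LeftModule R a ℓa
restrictScalars R S f hom M = record
  { Carrierᴹ = Carrierᴹ
  ; _≈ᴹ_ = _≈ᴹ_
  ; _+ᴹ_ = _+ᴹ_
  ; _*ₗ_ = λ s x → f s *ₗ x
  ; 0ᴹ = 0ᴹ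
  ; -ᴹ_ = -ᴹ_
  ; isLeftModule = record
    { isLeftSemimodule = record
      { +ᴹ-isCommutativeMonoid = +ᴹ-isCommutativeMonoid
      ; isPreleftSemimodule = record
        { *ₗ-cong = λ p q → *ₗ-cong (⟦⟧-cong p) q
        ; *ₗ-zeroˡ = λ x → ≈ᴹ-trans (*ₗ-cong 0#-homo ≈ᴹ-refl) (*ₗ-zeroˡ x)
        ; *ₗ-distribʳ = λ x s t →
            ≈ᴹ-trans (*ₗ-cong (+-homo s t) ≈ᴹ-refl) (*ₗ-distribʳ x (f s) (f t))
        ; *ₗ-identityˡ = λ x → ≈ᴹ-trans (*ₗ-cong 1#-homo ≈ᴹ-refl) (*ₗ-identityˡ x)
        ; *ₗ-assoc = λ s t x →
            ≈ᴹ-trans (*ₗ-cong (*-homo s t) ≈ᴹ-refl) (*ₗ-assoc (f s) (f t) x)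
        ; *ₗ-zeroʳ = λ s → *ₗ-zeroʳ (f s)
        ; *ₗ-distribˡ = λ s → *ₗ-distribˡ (f s)
        }
      }
    ; -ᴹ‿cong = -ᴹ‿cong
    ; -ᴹ‿inverse = -ᴹ‿inverse
    }
  }
  where
  open LeftModule M
  open IsRingHomomorphism hom

-- The extension 𝔽_{q^m} / 𝔽_q, given by F with q elements, E with q^m elements,
-- and an embedding ι (a homomorphism of fields is automatically injective).
record FiniteFieldExtension (q m : ℕ) (c₁ ℓ₁ c₂ ℓ₂ : Level)
                            : Set (suc (c₁ ⊔ ℓ₁ ⊔ c₂ ⊔ ℓ₂)) where
  field
    F : Field c₁ ℓ₁
    E : Field c₂ ℓ₂
  module F = Field F
  module E = Field E
  field
    F-cardinality     : HasCardinality F q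
    E-cardinality     : HasCardinality E (q ^ m)
    ι                 : F.Carrier → E.Carrier
    ι-isHomomorphism  : IsRingHomomorphism F.rawRing E.rawRing ι

  E-over-F : LeftModule F.ring c₂ ℓ₂
  E-over-F = restrictScalars F.ring E.ring ι ι-isHomomorphism leftModule

  Basis : Set (c₁ ⊔ ℓ₁ ⊔ c₂ ⊔ ℓ₂)
  Basis = ∃[ Γ ] Linear.IsBasis E-over-F {k = m} U Γ

module RankMetric {q m c₁ ℓ₁ c₂ ℓ₂} (X : FiniteFieldExtension q m c₁ ℓ₁ c₂ ℓ₂)
                  (Γ : FiniteFieldExtension.Basis X) where

  open FiniteFieldExtension X using (module F; module E)

  private
    module Fⁿ n = LeftModule (coordinateSpace F.ring n)
    module Eⁿ n = LeftModule (coordinateSpace E.ring n)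
    module LF n = Linear (coordinateSpace F.ring n)
    module LE n = Linear (coordinateSpace E.ring n)

  coordinates : E.Carrier → Vector F.Carrier m
  coordinates x = proj₁ (Linear.IsBasis.spanning (proj₂ Γ) {x} tt)

  -- Indexed by row, then column: the j-th column holds the coordinates of x j.
  Mat : ∀ {n} → Vector E.Carrier n → Vector (Vector F.Carrier n) m
  Mat x i j = coordinates (x j) i

  support : ∀ {n} → Vector E.Carrier n → Pred (Vector F.Carrier n) (c₁ ⊔ ℓ₁)
  support {n} x = LF.Span n (Mat x)

  HasRank : ∀ {n} → Vector E.Carrier n → ℕ → Set (c₁ ⊔ ℓ₁)
  HasRank {n} x r = LF.HasDimension n (support x) r

  NonZeroIn : ∀ {n p} → Pred (Vector E.Carrier n) p → Pred (Vector E.Carrier n) (ℓ₂ ⊔ p)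
  NonZeroIn {n} C c = c ∈ C × ¬ (Eⁿ._≈ᴹ_ n c (Eⁿ.0ᴹ n))

  record IsMinimumDistance {n p} (C : Pred (Vector E.Carrier n) p) (d : ℕ)
                           : Set (c₁ ⊔ ℓ₁ ⊔ c₂ ⊔ ℓ₂ ⊔ p) where
    field
      attained   : ∃[ c ] c ∈ NonZeroIn C × HasRank c d
      lowerBound : ∀ c r → c ∈ NonZeroIn C → HasRank c r → d ≤ r

  record Code (n k d : ℕ) : Set (c₁ ⊔ ℓ₁ ⊔ suc (c₂ ⊔ ℓ₂)) where
    field
      codewords       : Pred (Vector E.Carrier n) (c₂ ⊔ ℓ₂)
      isSubspace      : LE.IsSubspace n codewords
      1≤k             : 1 ≤ k
      dimension       : LE.HasDimension n codewords k
      minimumDistance : IsMinimumDistance codewords d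

  module _ {n k d} (𝒞 : Code n k d) where
    open Code 𝒞

    Nondegenerate : Set (c₁ ⊔ ℓ₁ ⊔ c₂ ⊔ ℓ₂)
    Nondegenerate = ∀ v → v ∈ LF.Sum n {I = ∃ codewords} (λ (c , _) → support c)

    -- The intersection is a subspace, so differing from {0} means containing a
    -- nonzero vector.
    Intersecting : Set (c₁ ⊔ ℓ₁ ⊔ c₂ ⊔ ℓ₂)
    Intersecting = ∀ c c′ → c ∈ NonZeroIn codewords → c′ ∈ NonZeroIn codewords →
      ∃[ v ] v ∈ support c ∩ support c′ × ¬ (Fⁿ._≈ᴹ_ n v (Fⁿ.0ᴹ n))

{-# OPTIONS --safe #-}

-- The codeword of a ∈ Eᵏ is (f(Γ₁), …, f(Γₘ), a₁Γ₁, …, a₁Γₙ₋ₘ), where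
-- f = a₀ + a₁σ + ⋯ + aₖ₋₁σᵏ⁻¹ and σ is the q-th power map: a Gabidulin code of length m,
-- lengthened so as to stay nondegenerate.  If a ≠ 0 then ker f has dimension at
-- most k − 1 over F, so the first m entries alone give rank at least m − k + 1,
-- which exceeds n / 2.  Two supports of dimension greater than n / 2 in Fⁿ
-- meet, so the code is intersecting.
--
-- Dimensions are compared by counting: an injection of E into Fʳ × Fᵏ⁻¹ gives
-- m ≤ r + k − 1.  The minimum distance exists because there are only finitely
-- many codewords.

module Submission where

open import Defs
open import Algebra.Bundles using (CommutativeMonoid; CommutativeRing; Ring)
import Algebra.Properties.AbelianGroup as GroupProperties
import Algebra.Properties.CommutativeMonoid.Sum as MonoidSum
import Algebra.Properties.CommutativeSemiring.Binomial as Binomial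
import Algebra.Properties.CommutativeSemiring.Exp as Exp
import Algebra.Properties.Ring as RingProperties
import Algebra.Properties.Semiring.Mult as Mult
import Algebra.Properties.Semiring.Sum as SemiringSum
import Algebra.Solver.Ring.NaturalCoefficients.Default as Solver
open import Algebra.Module.Bundles using (LeftModule)
open import Algebra.Module.Construct.TensorUnit using (leftModule)
open import Algebra.Morphism.Structures using (IsRingHomomorphism)
open import Data.Fin.Base as Fin using (Fin; zero; suc; toℕ)
import Data.Fin.Properties as Finₚ
open import Data.Nat as ℕ using (ℕ; zero; suc; _≤_; _<_; z≤n; s≤s)
open import Data.Nat.Combinatorics using (_C_; nCk≡n!/k![n-k]!; nCn≡1)
open import Data.Nat.Combinatorics.Specification using ([n∸k]!k!∣n!)
open import Data.Nat.DivMod using (_/_; m/n*n≡m; m/n*n≤m)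
open import Data.Nat.Divisibility using (_∣_; divides; ∣⇒≤; ∣-refl; ∣m⇒∣m*n)
open import Data.Nat.Primality using (Prime; euclidsLemma; prime⇒nonZero; prime⇒nonTrivial)
import Data.Nat.Properties as ℕₚ
open import Data.Nat.Tactic.RingSolver using (solve-∀)
open import Data.Product using (∃; ∃-syntax; ∃₂; Σ-syntax; _×_; _,_; proj₁; proj₂)
open import Data.Product.Function.NonDependent.Setoid using (_×-inverse_)
open import Data.Product.Relation.Binary.Pointwise.NonDependent using (×-setoid)
open import Data.Sum.Base using (inj₁; inj₂)
open import Data.Unit.Base using (tt)
open import Data.Vec.Functional using (Vector; []; _∷_; _++_; init; last; removeAt; replicate; tail)
open import Data.Vec.Functional.Properties using (lookup-++ˡ; lookup-++ʳ)
open import Data.Vec.Functional.Relation.Binary.Equality.Setoid using (≋-setoid)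
open import Function.Base using (_∘_; id)
open import Function.Bundles using (Inverse)
import Function.Construct.Composition as Composition
import Function.Construct.Symmetry as Symmetry
open import Level using (_⊔_)
open import Relation.Binary.Bundles using (Setoid)
open import Relation.Binary.Definitions using (Decidable)
open import Relation.Binary.PropositionalEquality as ≡ using (_≡_; cong; subst)
import Relation.Binary.Reasoning.Setoid as ≈-Reasoning
open import Relation.Nullary.Decidable using (Dec; yes; no; ¬?; map′; _×-dec_; decidable-stable)
open import Relation.Nullary.Negation using (¬_; contradiction)
import Relation.Unary as U

-- Arithmetic and finite setoids

-- The kernel bound never mentions a basis of the kernel. What is shown is that on every fibre of f,
-- k - 1 functions into F tell the points apart, and this is the form that the counting consumes.
-- The induction divides out one kernel vector at a time, which needs the kernel of σ - 1 to be
-- exactly F. That rests on three facts about finite fields: x^q = x on F, X^q - X has at most q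
-- roots, and the q-th power is additive because q is a power of the characteristic. The range of n
-- is what the distance allows: n < 2(m - k + 1) says n ≤ 2m - 2k + 1. The same inequality gives n -
-- m ≤ m, so Γ has enough elements for the added entries, and k ≥ 2 provides the coefficient a₁ that
-- carries them.

p∤n! : ∀ {p} → Prime p → ∀ n → n < p → ¬ p ∣ n ℕ.!
p∤n! pr zero _ p∣1 with ∣⇒≤ p∣1
... | p≤1 = ℕₚ.<⇒≱ (ℕ.nonTrivial⇒n>1 _ {{prime⇒nonTrivial pr}}) p≤1
p∤n! pr (suc n) n<p p∣ with euclidsLemma (suc n) (n ℕ.!) pr p∣
... | inj₁ p∣1+n = ℕₚ.<⇒≱ n<p (∣⇒≤ p∣1+n)
... | inj₂ p∣n!  = p∤n! pr n (ℕₚ.<-trans (ℕₚ.n<1+n n) n<p) p∣n!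

-- `p` divides `p ! = (p C k) * (k ! * (p ∸ k) !)`, and neither factorial on the right is divisible
-- by `p`, as `k` and `p ∸ k` are both below `p`.
p∣pCk : ∀ {p} → Prime p → ∀ k → 0 < k → k < p → p ∣ p C k
p∣pCk {p} pr k 0<k k<p
  with euclidsLemma (p C k) _ pr (subst (p ∣_) p!≡ (n∣n! p {{prime⇒nonZero pr}}))
  where
  instance _ = k ℕₚ.!* (p ℕ.∸ k) !≢0
  p!≡ : p ℕ.! ≡ (p C k) ℕ.* (k ℕ.! ℕ.* (p ℕ.∸ k) ℕ.!)
  p!≡ = ≡.sym (≡.trans (cong (ℕ._* (k ℕ.! ℕ.* (p ℕ.∸ k) ℕ.!)) (nCk≡n!/k![n-k]! (ℕₚ.<⇒≤ k<p)))
                       (m/n*n≡m (subst (_∣ p ℕ.!) (ℕₚ.*-comm _ (k ℕ.!)) ([n∸k]!k!∣n! (ℕₚ.<⇒≤ k<p)))))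
  n∣n! : ∀ n → .{{ℕ.NonZero n}} → n ∣ n ℕ.!
  n∣n! (suc n) = ∣m⇒∣m*n (n ℕ.!) ∣-refl
... | inj₁ p∣C = p∣C
... | inj₂ p∣k![p-k]! with euclidsLemma (k ℕ.!) _ pr p∣k![p-k]!
...   | inj₁ p∣k!     = contradiction p∣k! (p∤n! pr k k<p)
...   | inj₂ p∣[p-k]! = contradiction p∣[p-k]!
                          (p∤n! pr (p ℕ.∸ k) (ℕₚ.∸-monoʳ-< 0<k (ℕₚ.<⇒≤ k<p)))

Finite : ∀ {c ℓ} → Setoid c ℓ → ℕ → Set (c ⊔ ℓ)
Finite S n = Inverse S (≡.setoid (Fin n))

module _ {c ℓ} {S : Setoid c ℓ} {n} (fin : Finite S n) where
  open Setoid S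
  open Inverse fin

  from-to : ∀ x → from (to x) ≈ x
  from-to = strictlyInverseʳ

  to-injective : ∀ {x y} → to x ≡ to y → x ≈ y
  to-injective {x} {y} eq = trans (sym (from-to x)) (trans (from-cong eq) (from-to y))

  from-injective : ∀ {i j} → from i ≈ from j → i ≡ j
  from-injective {i} {j} eq =
    ≡.trans (≡.sym (strictlyInverseˡ i)) (≡.trans (to-cong eq) (strictlyInverseˡ j))

  finite-≟ : Decidable _≈_
  finite-≟ x y = map′ to-injective to-cong (to x Finₚ.≟ to y)

  -- Only the representatives `from i` are searched, so `P` has to respect `_≈_` for the answer to
  -- cover the whole setoid.
  finite-any? : ∀ {p} {P : U.Pred Carrier p} → (∀ {x y} → x ≈ y → P x → P y) →
                U.Decidable P → Dec (∃ P)
  finite-any? resp P? = map′ (λ (i , p) → from i , p)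
                             (λ (x , p) → to x , resp (sym (from-to x)) p)
                             (Finₚ.any? (P? ∘ from))

finite-× : ∀ {a ℓa b ℓb} {A : Setoid a ℓa} {B : Setoid b ℓb} {m n} →
           Finite A m → Finite B n → Finite (×-setoid A B) (m ℕ.* n)
finite-× {A = A} {B} α β =
  Composition.inverse (α ×-inverse β)
    (Composition.inverse (record
      { to = id ; from = id
      ; to-cong = λ (eq₁ , eq₂) → ≡.cong₂ _,_ eq₁ eq₂
      ; from-cong = λ { ≡.refl → ≡.refl , ≡.refl }
      ; inverse = (λ { (≡.refl , ≡.refl) → ≡.refl }) , (λ { ≡.refl → ≡.refl , ≡.refl }) })
    (Symmetry.inverse Finₚ.*↔×))

finite-^ : ∀ {c ℓ} {S : Setoid c ℓ} {n} → Finite S n → ∀ k → Finite (≋-setoid S k) (n ℕ.^ k)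
finite-^ {S = S} {n} fin k = record
  { to        = λ v → Fin.funToFin (to ∘ v)
  ; from      = λ i → from ∘ Fin.finToFun i
  ; to-cong   = λ v≈w → funToFin-cong (to-cong ∘ v≈w)
  ; from-cong = λ { ≡.refl _ → S.refl }
  ; inverse   = (λ {i} v≈ → ≡.trans (funToFin-cong (λ j → inverseˡ (v≈ j)))
                                    (Finₚ.funToFin-finToFin {k} {n} i))
              , (λ { {v} ≡.refl j → S.trans (from-cong (Finₚ.finToFun-funToFin (to ∘ v) j)) (from-to fin (v j)) })
  }
  where
  open Inverse fin
  module S = Setoid S
  funToFin-cong : ∀ {k} {f g : Fin k → Fin n} → (∀ i → f i ≡ g i) → Fin.funToFin f ≡ Fin.funToFin g
  funToFin-cong {zero}  f≗g = ≡.refl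
  funToFin-cong {suc k} f≗g = ≡.cong₂ Fin.combine (f≗g zero) (funToFin-cong (f≗g ∘ suc))

module _ {a ℓa b ℓb} {A : Setoid a ℓa} {B : Setoid b ℓb} {m n}
         (α : Finite A m) (β : Finite B n) (f : Setoid.Carrier A → Setoid.Carrier B) where
  private
    module A = Inverse α
    module B = Inverse β

  finite-injective⇒≤ : (∀ {x y} → Setoid._≈_ B (f x) (f y) → Setoid._≈_ A x y) → m ≤ n
  finite-injective⇒≤ inj =
    Finₚ.injective⇒≤ {f = B.to ∘ f ∘ A.from} (from-injective α ∘ inj ∘ to-injective β)

  finite-pigeonhole : n < m → ∃₂ λ x y → ¬ Setoid._≈_ A x y × Setoid._≈_ B (f x) (f y)
  finite-pigeonhole n<m with Finₚ.pigeonhole n<m (B.to ∘ f ∘ A.from)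
  ... | i , j , i<j , eq =
    A.from i , A.from j , (λ xᵢ≈xⱼ → Finₚ.<⇒≢ i<j (from-injective α xᵢ≈xⱼ)) , to-injective β eq

argmin : ∀ {n p} {P : U.Pred (Fin n) p} → U.Decidable P → (ρ : Fin n → ℕ) → ∃ P →
         ∃[ x ] P x × (∀ y → P y → ρ x ≤ ρ y)
argmin {P = P} P? ρ (x₀ , px₀) = go (ρ x₀) x₀ px₀ ℕₚ.≤-refl
  where
  -- `b` is fuel: each replacement of `x` lowers `ρ x` strictly, so the bound drops by at least one.
  go : ∀ b x → P x → ρ x ≤ b → ∃[ x ] P x × (∀ y → P y → ρ x ≤ ρ y)
  go zero x px ρx≤0 = x , px , λ y _ → ℕₚ.≤-trans ρx≤0 z≤n
  go (suc b) x px ρx≤b with Finₚ.any? (λ y → P? y ×-dec (ρ y ℕₚ.<? ρ x))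
  ... | yes (y , py , ρy<ρx) = go b y py (ℕ.s≤s⁻¹ (ℕₚ.<-≤-trans ρy<ρx ρx≤b))
  ... | no  none             = x , px , λ y py → ℕₚ.≮⇒≥ (λ ρy<ρx → none (y , py , ρy<ρx))

^-cancelˡ-≤ : ∀ {q m n} → 1 < q → q ℕ.^ m ≤ q ℕ.^ n → m ≤ n
^-cancelˡ-≤ {q} 1<q qᵐ≤qⁿ = ℕₚ.≮⇒≥ (λ n<m → ℕₚ.<⇒≱ (ℕₚ.^-monoʳ-< q 1<q n<m) qᵐ≤qⁿ)

module _ where
  open import Data.Nat using (_+_; _*_; _∸_)

  -- Truncated subtraction disappears here: `k + 1 ≤ 2 * k ≤ m + 1` gives `k ≤ m`, so
  -- `2 * m ∸ 2 * k` is a true difference.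
  length-bounds : ∀ {m k n} → 2 ≤ k → k ≤ (m + 1) / 2 → m ≤ n → n ≤ 2 * m ∸ 2 * k + 1 →
                  k ≤ m × n + 2 * k ≤ 2 * m + 1
  length-bounds {m} {k} {n} 2≤k k≤ m≤n n≤ = k≤m , (begin
    n + 2 * k                    ≤⟨ ℕₚ.+-monoˡ-≤ (2 * k) n≤ ⟩
    2 * m ∸ 2 * k + 1 + 2 * k    ≡⟨ ℕₚ.+-assoc (2 * m ∸ 2 * k) 1 _ ⟩
    2 * m ∸ 2 * k + (1 + 2 * k)  ≡⟨ cong (2 * m ∸ 2 * k +_) (ℕₚ.+-comm 1 _) ⟩
    2 * m ∸ 2 * k + (2 * k + 1)  ≡⟨ ℕₚ.+-assoc (2 * m ∸ 2 * k) _ 1 ⟨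
    2 * m ∸ 2 * k + 2 * k + 1    ≡⟨ cong (ℕ._+ 1) (ℕₚ.m∸n+n≡m (ℕₚ.*-monoʳ-≤ 2 k≤m)) ⟩
    2 * m + 1  ∎)
    where
    open ℕₚ.≤-Reasoning
    k≤m : k ≤ m
    k≤m = ℕₚ.+-cancelʳ-≤ 1 k m (begin
      k + 1            ≤⟨ ℕₚ.+-monoʳ-≤ k (ℕₚ.≤-trans (s≤s z≤n) 2≤k) ⟩
      k + k            ≡⟨ cong (k +_) (ℕₚ.+-identityʳ k) ⟨
      2 * k            ≡⟨ ℕₚ.*-comm 2 k ⟩
      k * 2            ≤⟨ ℕₚ.*-monoˡ-≤ 2 k≤ ⟩
      (m + 1) / 2 * 2  ≤⟨ m/n*n≤m (m + 1) 2 ⟩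
      m + 1  ∎)

  -- The added entries use distinct members of `Γ`, so there may be at most `m` of them. In this
  -- lemma and the next, `suc k` is the dimension of the code.
  extension-bound : ∀ {m k n′} → m + n′ + 2 * suc k ≤ 2 * m + 1 → n′ ≤ m
  extension-bound {m} {k} {n′} h = ℕₚ.≤-trans (ℕₚ.m≤m+n n′ (2 * k + 1)) (ℕₚ.+-cancelˡ-≤ (suc m) _ _ (begin
    suc m + (n′ + (2 * k + 1))  ≡⟨ lhs m n′ k ⟩
    m + n′ + 2 * suc k          ≤⟨ h ⟩
    2 * m + 1                   ≡⟨ rhs m ⟩
    suc m + m  ∎))
    where
    open ℕₚ.≤-Reasoning
    lhs : ∀ m n′ k → suc m + (n′ + (2 * k + 1)) ≡ m + n′ + 2 * suc k
    lhs = solve-∀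
    rhs : ∀ m → 2 * m + 1 ≡ suc m + m
    rhs = solve-∀

  distance-bound : ∀ {m k n d} → n + 2 * suc k ≤ 2 * m + 1 → m ≤ d + k → n < 2 * d
  distance-bound {m} {k} {n} {d} h m≤d+k = ℕₚ.+-cancelʳ-≤ (2 * k + 1) (suc n) (2 * d) (begin
    suc n + (2 * k + 1)  ≡⟨ lhs n k ⟩
    n + 2 * suc k        ≤⟨ h ⟩
    2 * m + 1            ≤⟨ ℕₚ.+-monoˡ-≤ 1 (ℕₚ.*-monoʳ-≤ 2 m≤d+k) ⟩
    2 * (d + k) + 1      ≡⟨ rhs d k ⟩
    2 * d + (2 * k + 1)  ∎)
    where
    open ℕₚ.≤-Reasoning
    lhs : ∀ n k → suc n + (2 * k + 1) ≡ n + 2 * suc k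
    lhs = solve-∀
    rhs : ∀ d k → 2 * (d + k) + 1 ≡ 2 * d + (2 * k + 1)
    rhs = solve-∀

↑-elim : ∀ {p} m n (P : U.Pred (Fin (m ℕ.+ n)) p) →
         (∀ i → P (i Fin.↑ˡ n)) → (∀ j → P (m Fin.↑ʳ j)) → ∀ k → P k
↑-elim m n P left right k with Fin.splitAt m k | Finₚ.join-splitAt m n k
... | inj₁ i | ≡.refl = left i
... | inj₂ j | ≡.refl = right j

padRight : ∀ {a} {A : Set a} {m n} → m ≤ n → A → Vector A m → Vector A n
padRight z≤n       x v _       = x
padRight (s≤s m≤n) x v zero    = v zero
padRight (s≤s m≤n) x v (suc i) = padRight m≤n x (tail v) i

padRight-inject≤ : ∀ {a} {A : Set a} {m n} (m≤n : m ≤ n) (x : A) (v : Vector A m) i →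
                   padRight m≤n x v (Fin.inject≤ i m≤n) ≡ v i
padRight-inject≤ (s≤s m≤n) x v zero    = ≡.refl
padRight-inject≤ (s≤s m≤n) x v (suc i) = padRight-inject≤ m≤n x (tail v) i

-- Serves two classical arguments: adding up a finite field after a translation, and multiplying up
-- its units after a scaling.
sum-reindex : ∀ {c ℓ a ℓa} (M : CommutativeMonoid c ℓ) {S : Setoid a ℓa} {n}
              (fin : Finite S n) (φ : Inverse S S) →
              let open CommutativeMonoid M; open MonoidSum M; open Inverse in
              (g : Setoid.Carrier S → Carrier) → (∀ {x y} → Setoid._≈_ S x y → g x ≈ g y) →
              sum (g ∘ from fin) ≈ sum (g ∘ to φ ∘ from fin)
sum-reindex M {S} fin φ g g-cong =
  trans (sum-permute (g ∘ F.from) (Composition.inverse (Symmetry.inverse fin)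
                                     (Composition.inverse φ fin)))
        (sum-cong-≋ (λ i → g-cong (from-to fin (Inverse.to φ (F.from i)))))
  where
  open CommutativeMonoid M
  open MonoidSum M
  module F = Inverse fin

-- Powers in characteristic p

module Characteristic {c ℓ} (R : CommutativeRing c ℓ) where
  open CommutativeRing R hiding (zero)
  open Exp commutativeSemiring
  open Mult semiring using (×-homo-1; ×-assocˡ; ×-congʳ; ×-assoc-*) renaming (_×_ to _·_)
  open SemiringSum semiring

  ∣⇒·≈0 : ∀ {p n} → p · 1# ≈ 0# → p ∣ n → ∀ x → n · x ≈ 0#
  ∣⇒·≈0 {p} p·1≈0 (divides k ≡.refl) x = begin
    (k ℕ.* p) · x       ≈⟨ ×-assocˡ x k p ⟨
    k · (p · x)         ≈⟨ ×-congʳ k (×-congʳ p (*-identityˡ x)) ⟨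
    k · (p · (1# * x))  ≈⟨ ×-congʳ k (×-assoc-* p 1# x) ⟨
    k · ((p · 1#) * x)  ≈⟨ ×-congʳ k (*-congʳ p·1≈0) ⟩
    k · (0# * x)        ≈⟨ ×-congʳ k (zeroˡ x) ⟩
    k · 0#              ≈⟨ sum-replicate k ⟨
    sum (replicate k 0#) ≈⟨ sum-replicate-zero k ⟩
    0#                  ∎
    where open ≈-Reasoning setoid

  -- The inner binomial coefficients are multiples of `p`, so only the two end terms survive. Term
  -- `zero` of the expansion is the pure power of `y`, hence the final swap.
  ^p-homo-+ : ∀ {p} → Prime p → p · 1# ≈ 0# → ∀ x y → (x + y) ^ p ≈ x ^ p + y ^ p
  ^p-homo-+ {zero}  pr _ = contradiction ≡.refl (ℕ.≢-nonZero⁻¹ 0 {{prime⇒nonZero pr}})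
  ^p-homo-+ {suc n} pr n·1≈0 x y = begin
    (x + y) ^ suc n
      ≈⟨ Binomial.theorem commutativeSemiring (suc n) x y ⟩
    term zero + sum (tail term)
      ≈⟨ +-congˡ (sum-init-last (tail term)) ⟩
    term zero + (sum (init (tail term)) + last (tail term))
      ≈⟨ +-cong first (+-cong middle final) ⟩
    y ^ suc n + (0# + x ^ suc n)
      ≈⟨ +-congˡ (+-identityˡ _) ⟩
    y ^ suc n + x ^ suc n
      ≈⟨ +-comm _ _ ⟩
    x ^ suc n + y ^ suc n ∎
    where
    open ≈-Reasoning setoid
    term = Binomial.binomialTerm commutativeSemiring x y (suc n)
    first : term zero ≈ y ^ suc n
    first = trans (×-homo-1 _) (*-identityˡ _)
    middle : sum (init (tail term)) ≈ 0#
    middle = trans (sum-cong-≋ (λ i → ∣⇒·≈0 n·1≈0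
      (p∣pCk pr _ (s≤s z≤n) (s≤s (subst (_< n) (≡.sym (Finₚ.toℕ-inject₁ i)) (Finₚ.toℕ<n i)))) _))
      (sum-replicate-zero n)
    final : last (tail term) ≈ x ^ suc n
    final rewrite Finₚ.toℕ-fromℕ n | nCn≡1 (suc n) | ℕₚ.n∸n≡0 n =
      trans (×-homo-1 _) (*-identityʳ _)

  ^[p^e]-homo-+ : ∀ {p} → Prime p → p · 1# ≈ 0# → ∀ e x y → (x + y) ^ (p ℕ.^ e) ≈ x ^ (p ℕ.^ e) + y ^ (p ℕ.^ e)
  ^[p^e]-homo-+ _ _ zero x y = trans (*-identityʳ _) (sym (+-cong (*-identityʳ x) (*-identityʳ y)))
  ^[p^e]-homo-+ {p} pr p·1≈0 (suc e) x y = begin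
    (x + y) ^ (p ℕ.* p ℕ.^ e)               ≈⟨ ^-assocʳ _ p (p ℕ.^ e) ⟨
    ((x + y) ^ p) ^ (p ℕ.^ e)               ≈⟨ ^-congˡ (p ℕ.^ e) (^p-homo-+ pr p·1≈0 x y) ⟩
    (x ^ p + y ^ p) ^ (p ℕ.^ e)             ≈⟨ ^[p^e]-homo-+ pr p·1≈0 e _ _ ⟩
    (x ^ p) ^ (p ℕ.^ e) + (y ^ p) ^ (p ℕ.^ e)
      ≈⟨ +-cong (^-assocʳ x p _) (^-assocʳ y p _) ⟩
    x ^ (p ℕ.* p ℕ.^ e) + y ^ (p ℕ.* p ℕ.^ e) ∎
    where open ≈-Reasoning setoid

-- Polynomials

module Polynomial {c ℓ} (R : CommutativeRing c ℓ) where
  open CommutativeRing R hiding (zero)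
  open Solver commutativeSemiring using (solve; _:+_; _:*_; _:=_; con)

  eval : ∀ {n} → Vector Carrier n → Carrier → Carrier
  eval {zero}  a x = 0#
  eval {suc n} a x = a zero + x * eval (tail a) x

  eval-cong : ∀ {n} (a : Vector Carrier n) {x y} → x ≈ y → eval a x ≈ eval a y
  eval-cong {zero}  a x≈y = refl
  eval-cong {suc n} a x≈y = +-congˡ (*-cong x≈y (eval-cong (tail a) x≈y))

  -- Synthetic division: with a = a₀ + X t, the polynomial (a - a(r)) / (X - r) equals t(r) + X (t -
  -- t(r)) / (X - r).
  quotient : ∀ {n} → Carrier → Vector Carrier (suc n) → Vector Carrier n
  quotient {suc n} r a zero    = eval (tail a) r
  quotient {suc n} r a (suc i) = quotient r (tail a) i

  -- The division of a by X − r, written at x = r + d to avoid subtraction.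
  eval-quotient : ∀ {n} (a : Vector Carrier (suc n)) r d →
                  eval a (r + d) ≈ eval a r + d * eval (quotient r a) (r + d)
  eval-quotient {zero} a r d =
    solve 3 (λ a r d → a :+ (r :+ d) :* con 0 := (a :+ r :* con 0) :+ d :* con 0) refl (a zero) r d
  eval-quotient {suc n} a r d = trans
    (+-congˡ (*-congˡ (eval-quotient (tail a) r d)))
    (solve 5 (λ a r d t u → a :+ (r :+ d) :* (t :+ d :* u) :=
                            (a :+ r :* t) :+ d :* (t :+ (r :+ d) :* u))
             refl (a zero) r d (eval (tail a) r) (eval (quotient r (tail a)) (r + d)))

  quotient≈0⇒≈0 : ∀ {n} r (a : Vector Carrier (suc n)) → (∀ i → quotient r a i ≈ 0#) →
                  eval a r ≈ 0# → ∀ i → a i ≈ 0#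
  quotient≈0⇒≈0 {n} r a q≈0 a[r]≈0 = λ
    { zero    → trans (sym (trans (+-congˡ (trans (*-congˡ (tail[r]≈0 n a q≈0)) (zeroʳ r))) (+-identityʳ _))) a[r]≈0
    ; (suc i) → rest n a q≈0 i }
    where
    tail[r]≈0 : ∀ n (a : Vector Carrier (suc n)) → (∀ i → quotient r a i ≈ 0#) → eval (tail a) r ≈ 0#
    tail[r]≈0 zero    a q≈0 = refl
    tail[r]≈0 (suc n) a q≈0 = q≈0 zero
    rest : ∀ n (a : Vector Carrier (suc n)) → (∀ i → quotient r a i ≈ 0#) → ∀ i → tail a i ≈ 0#
    rest (suc n) a q≈0 = quotient≈0⇒≈0 r (tail a) (q≈0 ∘ suc) (q≈0 zero)

  monomial : ∀ n → Vector Carrier (suc n)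
  monomial zero    = 1# ∷ []
  monomial (suc n) = 0# ∷ monomial n

  open Exp commutativeSemiring using (_^_)
  eval-monomial : ∀ n x → eval (monomial n) x ≈ x ^ n
  eval-monomial zero x = trans (+-congˡ (zeroʳ x)) (+-identityʳ 1#)
  eval-monomial (suc n) x = trans (+-identityˡ _) (*-congˡ (eval-monomial n x))

module FieldProperties {c ℓ} (K : Field c ℓ) where
  open Field K hiding (zero)
  open Polynomial commutativeRing
  open GroupProperties +-abelianGroup public using () renaming (x∙y⁻¹≈ε⇒x≈y to x-y≈0⇒x≈y)

  *-cancelˡ-≉0 : ∀ {x y z} → ¬ x ≈ 0# → x * y ≈ x * z → y ≈ z
  *-cancelˡ-≉0 {x} {y} {z} x≉0 xy≈xz = begin
    y              ≈⟨ *-identityˡ y ⟨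
    1# * y         ≈⟨ *-congʳ x⁻¹x≈1 ⟨
    (x⁻¹ * x) * y  ≈⟨ *-assoc _ _ _ ⟩
    x⁻¹ * (x * y)  ≈⟨ *-congˡ xy≈xz ⟩
    x⁻¹ * (x * z)  ≈⟨ *-assoc _ _ _ ⟨
    (x⁻¹ * x) * z  ≈⟨ *-congʳ x⁻¹x≈1 ⟩
    1# * z         ≈⟨ *-identityˡ z ⟩
    z              ∎
    where
    open ≈-Reasoning setoid
    x⁻¹ = proj₁ (inverse x x≉0)
    x⁻¹x≈1 = proj₁ (proj₂ (inverse x x≉0))

  x*y≈0⇒y≈0 : ∀ {x y} → ¬ x ≈ 0# → x * y ≈ 0# → y ≈ 0#
  x*y≈0⇒y≈0 x≉0 xy≈0 = *-cancelˡ-≉0 x≉0 (trans xy≈0 (sym (zeroʳ _)))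

  -- Having `n` coefficients means degree below `n`. Dividing by X - r₀ keeps the other roots, since
  -- their differences from r₀ are nonzero and cancel.
  roots⇒≈0 : ∀ {n} (a r : Vector Carrier n) → (∀ i j → r i ≈ r j → i ≡ j) →
             (∀ i → eval a (r i) ≈ 0#) → ∀ i → a i ≈ 0#
  roots⇒≈0 {suc n} a r r-inj a[r]≈0 =
    quotient≈0⇒≈0 r₀ a
      (roots⇒≈0 (quotient r₀ a) (tail r)
        (λ i j eq → Finₚ.suc-injective (r-inj (suc i) (suc j) eq))
        (λ i → x*y≈0⇒y≈0 (dᵢ≉0 i) (divided i)))
      (a[r]≈0 zero)
    where
    open ≈-Reasoning setoid
    r₀ = r zero
    d : Fin n → Carrier
    d i = r (suc i) - r₀
    dᵢ≉0 : ∀ i → ¬ d i ≈ 0#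
    dᵢ≉0 i dᵢ≈0 with r-inj (suc i) zero (x-y≈0⇒x≈y _ _ dᵢ≈0)
    ... | ()
    r₀+d : ∀ i → r₀ + d i ≈ r (suc i)
    r₀+d i = begin
      r₀ + (r (suc i) - r₀)   ≈⟨ +-comm _ _ ⟩
      r (suc i) - r₀ + r₀     ≈⟨ +-assoc _ _ _ ⟩
      r (suc i) + (- r₀ + r₀) ≈⟨ +-congˡ (-‿inverseˡ r₀) ⟩
      r (suc i) + 0#          ≈⟨ +-identityʳ _ ⟩
      r (suc i)               ∎
    divided : ∀ i → d i * eval (quotient r₀ a) (r (suc i)) ≈ 0#
    divided i = begin
      d i * eval (quotient r₀ a) (r (suc i))             ≈⟨ *-congˡ (eval-cong (quotient r₀ a) (r₀+d i)) ⟨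
      d i * eval (quotient r₀ a) (r₀ + d i)              ≈⟨ +-identityˡ _ ⟨
      0# + d i * eval (quotient r₀ a) (r₀ + d i)         ≈⟨ +-congʳ (a[r]≈0 zero) ⟨
      eval a r₀ + d i * eval (quotient r₀ a) (r₀ + d i)  ≈⟨ eval-quotient a r₀ (d i) ⟨
      eval a (r₀ + d i)                                  ≈⟨ eval-cong a (r₀+d i) ⟩
      eval a (r (suc i))                                 ≈⟨ a[r]≈0 (suc i) ⟩
      0#                                                 ∎

  private
    open Exp commutativeSemiring using (_^_)

    -- This is X^(n+2) - X: the exponent is at least 2, so the coefficient -1 does not meet the
    -- leading one.
    Xⁿ-X : ∀ n → Vector Carrier (suc (2 ℕ.+ n))
    Xⁿ-X n = 0# ∷ (- 1# ∷ monomial n)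

  fixed-by-power-bound : ∀ {n} → 1 < n → (r : Vector Carrier (suc n)) →
                         (∀ i j → r i ≈ r j → i ≡ j) → ¬ (∀ i → r i ^ n ≈ r i)
  fixed-by-power-bound {suc zero} (s≤s ())
  fixed-by-power-bound {suc (suc n)} _ r r-inj rⁿ≈r =
    -- Too many roots force all coefficients to vanish, among them -1 at index 1.
    1≉0 (trans (sym (⁻¹-involutive 1#))
          (trans (-‿cong (roots⇒≈0 (Xⁿ-X n) r r-inj (λ i → root (rⁿ≈r i)) (suc zero))) ε⁻¹≈ε))
    where
    open GroupProperties +-abelianGroup using (⁻¹-involutive; ε⁻¹≈ε)
    open ≈-Reasoning setoid
    root : ∀ {x} → x ^ (2 ℕ.+ n) ≈ x → eval (Xⁿ-X n) x ≈ 0#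
    root {x} xⁿ≈x = begin
      0# + x * (- 1# + x * eval (monomial n) x)  ≈⟨ +-identityˡ _ ⟩
      x * (- 1# + x * eval (monomial n) x)       ≈⟨ distribˡ x _ _ ⟩
      x * - 1# + x * (x * eval (monomial n) x)
        ≈⟨ +-cong (trans (*-comm x _) (RingProperties.-1*x≈-x ring x))
                  (*-congˡ (*-congˡ (eval-monomial n x))) ⟩
      - x + x ^ (2 ℕ.+ n)                        ≈⟨ +-congˡ xⁿ≈x ⟩
      - x + x                                    ≈⟨ -‿inverseˡ x ⟩
      0#                                         ∎

-- Finite fields

module FiniteFieldProperties {c ℓ} (K : Field c ℓ) {N} (card : HasCardinality K N) where
  open Field K hiding (zero)
  open FieldProperties K public
  open Inverse card using (to; from)
  open Mult semiring using (×-congʳ; ×1-homo-*) renaming (_×_ to _·_)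
  open Exp commutativeSemiring
  private module Π = MonoidSum *-commutativeMonoid
  private module ∑ = SemiringSum semiring
  open ≈-Reasoning setoid

  infix 4 _≟_
  _≟_ : Decidable _≈_
  _≟_ = finite-≟ card

  1<N : 1 < N
  1<N = distinct⇒1< (1≉0 ∘ to-injective card)
    where
    distinct⇒1< : ∀ {n} {i j : Fin n} → ¬ i ≡ j → 1 < n
    distinct⇒1< {suc zero} {zero} {zero} i≢j = contradiction ≡.refl i≢j
    distinct⇒1< {suc (suc n)} _ = s≤s (s≤s z≤n)

  -- Translation by 1 permutes the field, so the sum S of all elements satisfies N · 1 + S = S.
  N·1≈0 : N · 1# ≈ 0#
  N·1≈0 = GroupProperties.identityˡ-unique +-abelianGroup (N · 1#) (∑.sum from) (begin
    N · 1# + ∑.sum from                          ≈⟨ +-congʳ (∑.sum-replicate N) ⟨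
    ∑.sum (replicate N 1#) + ∑.sum from          ≈⟨ ∑.∑-distrib-+ (replicate N 1#) from ⟨
    ∑.sum (λ i → 1# + from i)                    ≈⟨ sum-reindex +-commutativeMonoid card shift id id ⟨
    ∑.sum from                                   ∎)
    where
    shift : Inverse setoid setoid
    shift = record
      { to = 1# +_ ; from = - 1# +_ ; to-cong = +-congˡ ; from-cong = +-congˡ
      ; inverse = (λ eq → trans (+-congˡ eq) (\\-leftDividesˡ 1# _))
                , (λ eq → trans (+-congˡ eq) (\\-leftDividesʳ 1# _)) }
      where open GroupProperties +-abelianGroup using (\\-leftDividesˡ; \\-leftDividesʳ)

  -- `(p ^ e) · 1#` is a product of `e` factors `p · 1#`, and a field has no zero divisors.
  p·1≈0 : ∀ p e → N ≡ p ℕ.^ e → p · 1# ≈ 0#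
  p·1≈0 p e N≡p^e = go e (subst (λ n → n · 1# ≈ 0#) N≡p^e N·1≈0)
    where
    go : ∀ e → (p ℕ.^ e) · 1# ≈ 0# → p · 1# ≈ 0#
    go zero    eq = contradiction (trans (sym (+-identityʳ 1#)) eq) 1≉0
    go (suc e) eq with p · 1# ≟ 0#
    ... | yes p≈0 = p≈0
    ... | no  p≉0 = go e (x*y≈0⇒y≈0 p≉0 (trans (sym (×1-homo-* p (p ℕ.^ e))) eq))

  private
    -- The factor that `y` contributes to a product over the units: neutral when `y` is zero.
    -- Products over units thereby run over the whole enumeration of the field, and the unit group
    -- needs no enumeration of its own.
    nonzero : Carrier → Carrier → Carrier
    nonzero x y with y ≟ 0#
    ... | yes _ = 1#
    ... | no  _ = x

    nonzero-≈0 : ∀ x {y} → y ≈ 0# → nonzero x y ≈ 1#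
    nonzero-≈0 x {y} y≈0 with y ≟ 0#
    ... | yes _ = refl
    ... | no y≉0 = contradiction y≈0 y≉0

    nonzero-≉0 : ∀ x {y} → ¬ y ≈ 0# → nonzero x y ≈ x
    nonzero-≉0 x {y} y≉0 with y ≟ 0#
    ... | yes y≈0 = contradiction y≈0 y≉0
    ... | no _ = refl

    nonzero-self≉0 : ∀ y → ¬ nonzero y y ≈ 0#
    nonzero-self≉0 y with y ≟ 0#
    ... | yes _  = 1≉0
    ... | no y≉0 = y≉0

    nonzero-self-cong : ∀ {x y} → x ≈ y → nonzero x x ≈ nonzero y y
    nonzero-self-cong {x} {y} x≈y with x ≟ 0#
    ... | yes x≈0 = sym (nonzero-≈0 y (trans (sym x≈y) x≈0))
    ... | no  x≉0 = trans x≈y (sym (nonzero-≉0 y (x≉0 ∘ trans x≈y)))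

    nonzero-* : ∀ x y → ¬ x ≈ 0# → nonzero (x * y) (x * y) ≈ nonzero x y * nonzero y y
    nonzero-* x y x≉0 with y ≟ 0#
    ... | yes y≈0 = trans (nonzero-≈0 _ (trans (*-congˡ y≈0) (zeroʳ x))) (sym (*-identityˡ 1#))
    ... | no  y≉0 = nonzero-≉0 _ (y≉0 ∘ x*y≈0⇒y≈0 x≉0)

    product≉0 : ∀ {n} (v : Vector Carrier n) → (∀ i → ¬ v i ≈ 0#) → ¬ Π.sum v ≈ 0#
    product≉0 {zero}  v v≉0 = 1≉0
    product≉0 {suc n} v v≉0 eq = product≉0 (tail v) (v≉0 ∘ suc) (x*y≈0⇒y≈0 (v≉0 zero) eq)

    -- The product itself is x to the power n - 1; the additional factor `x` avoids the predecessor.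
    product-except : ∀ {n} (v : Vector Carrier n) i {x} → v i ≈ 1# →
                     (∀ j → ¬ j ≡ i → v j ≈ x) → x * Π.sum v ≈ x ^ n
    product-except {suc n} v i {x} vᵢ≈1 v≈x = *-congˡ (begin
      Π.sum v                     ≈⟨ Π.sum-remove v ⟩
      v i * Π.sum (removeAt v i)  ≈⟨ *-cong vᵢ≈1 (Π.sum-cong-≋ (λ j → v≈x _ (Finₚ.punchInᵢ≢i i j))) ⟩
      1# * Π.sum (replicate n x)  ≈⟨ *-identityˡ _ ⟩
      Π.sum (replicate n x)       ≈⟨ Π.sum-replicate n ⟩
      x ^ n                       ∎)

  -- Multiplication by x ≠ 0 permutes the units, so their product `Π.sum g` absorbs one factor x per
  -- unit. Cancelling it leaves `Π.sum h ≈ 1#`, that is, x^(N-1) = 1.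
  x^N≈x : ∀ x → x ^ N ≈ x
  x^N≈x x with x ≟ 0#
  ... | yes x≈0 = 0^N N (ℕₚ.<-trans (s≤s z≤n) 1<N)
    where
    0^N : ∀ n → 0 < n → x ^ n ≈ x
    0^N (suc n) _ = trans (*-congʳ x≈0) (trans (zeroˡ _) (sym x≈0))
  ... | no x≉0 = begin
    x ^ N                  ≈⟨ product-except h (to 0#) (nonzero-≈0 x (from-to card 0#))
                                (λ j j≢0 → nonzero-≉0 x (λ eq → j≢0 (from-injective card (trans eq (sym (from-to card 0#)))))) ⟨
    x * Π.sum h            ≈⟨ *-congˡ Πh≈1 ⟩
    x * 1#                 ≈⟨ *-identityʳ x ⟩
    x                      ∎
    where
    x⁻¹ = proj₁ (inverse x x≉0)
    scale : Inverse setoid setoid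
    scale = record
      { to = x *_ ; from = x⁻¹ *_ ; to-cong = *-congˡ ; from-cong = *-congˡ
      ; inverse = (λ eq → trans (*-congˡ eq) (cancel (proj₂ (proj₂ (inverse x x≉0)))))
                , (λ eq → trans (*-congˡ eq) (cancel (proj₁ (proj₂ (inverse x x≉0))))) }
      where
      cancel : ∀ {a b y} → a * b ≈ 1# → a * (b * y) ≈ y
      cancel ab≈1 = trans (sym (*-assoc _ _ _)) (trans (*-congʳ ab≈1) (*-identityˡ _))
    g h : Vector Carrier N
    g i = nonzero (from i) (from i)
    h i = nonzero x (from i)
    Πh≈1 : Π.sum h ≈ 1#
    Πh≈1 = *-cancelˡ-≉0 (product≉0 g (nonzero-self≉0 ∘ from)) (begin
      Π.sum g * Π.sum h  ≈⟨ *-comm _ _ ⟩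
      Π.sum h * Π.sum g  ≈⟨ Π.∑-distrib-+ h g ⟨
      Π.sum (λ i → h i * g i)
        ≈⟨ Π.sum-cong-≋ (λ i → nonzero-* x (from i) x≉0) ⟨
      Π.sum (λ i → nonzero (x * from i) (x * from i))
        ≈⟨ sum-reindex *-commutativeMonoid card scale (λ y → nonzero y y) nonzero-self-cong ⟨
      Π.sum g            ≈⟨ *-identityʳ _ ⟨
      Π.sum g * 1#       ∎)

-- Linear algebra

module LinearProperties {r ℓr a ℓa} {R : Ring r ℓr} (M : LeftModule R a ℓa) where
  open LeftModule M
  open Linear M
  private
    module R where
      open Ring R public
      open SemiringSum semiring public
    module ∑ = MonoidSum +ᴹ-commutativeMonoid
  open ≈-Reasoning ≈ᴹ-setoid

  combination-cong : ∀ {k} {s t : Vector R.Carrier k} {v : Vector Carrierᴹ k} →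
                     (∀ i → s i R.≈ t i) → combination s v ≈ᴹ combination t v
  combination-cong s≈t = ∑.sum-cong-≋ (λ i → *ₗ-cong (s≈t i) ≈ᴹ-refl)

  combination-0 : ∀ {k} (v : Vector Carrierᴹ k) → combination (λ _ → R.0#) v ≈ᴹ 0ᴹ
  combination-0 {k} v = ≈ᴹ-trans (∑.sum-cong-≋ (λ i → *ₗ-zeroˡ (v i))) (∑.sum-replicate-zero k)

  combination-+ : ∀ {k} s t (v : Vector Carrierᴹ k) →
                  combination (λ i → s i R.+ t i) v ≈ᴹ combination s v +ᴹ combination t v
  combination-+ s t v = ≈ᴹ-trans (∑.sum-cong-≋ (λ i → *ₗ-distribʳ (v i) (s i) (t i)))
                                 (∑.∑-distrib-+ (λ i → s i *ₗ v i) (λ i → t i *ₗ v i))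

  combination-* : ∀ {k} x s (v : Vector Carrierᴹ k) →
                  combination (λ i → x R.* s i) v ≈ᴹ x *ₗ combination s v
  combination-* {zero}  x s v = ≈ᴹ-sym (*ₗ-zeroʳ x)
  combination-* {suc k} x s v = begin
    (x R.* s zero) *ₗ v zero +ᴹ combination (λ i → x R.* s (suc i)) (tail v)
      ≈⟨ +ᴹ-cong (*ₗ-assoc x (s zero) (v zero)) (combination-* x (tail s) (tail v)) ⟩
    x *ₗ (s zero *ₗ v zero) +ᴹ x *ₗ combination (tail s) (tail v)
      ≈⟨ *ₗ-distribˡ x _ _ ⟨
    x *ₗ combination s v ∎

  span-isSubspace : ∀ {k} (v : Vector Carrierᴹ k) → IsSubspace (Span v)
  span-isSubspace v = record
    { resp     = λ x≈y (s , eq) → s , ≈ᴹ-trans eq x≈y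
    ; 0-closed = (λ _ → R.0#) , combination-0 v
    ; +-closed = λ (s , eq) (t , eq′) →
        (λ i → s i R.+ t i) , ≈ᴹ-trans (combination-+ s t v) (+ᴹ-cong eq eq′)
    ; *-closed = λ x (s , eq) →
        (λ i → x R.* s i) , ≈ᴹ-trans (combination-* x s v) (*ₗ-cong R.refl eq)
    }

  combination-closed : ∀ {p k} {V : U.Pred Carrierᴹ p} → IsSubspace V →
                       ∀ s (v : Vector Carrierᴹ k) → (∀ i → v i U.∈ V) → combination s v U.∈ V
  combination-closed {k = zero}  V s v v∈V = IsSubspace.0-closed V
  combination-closed {k = suc k} V s v v∈V =
    IsSubspace.+-closed V (IsSubspace.*-closed V (s zero) (v∈V zero))
                          (combination-closed V (tail s) (tail v) (v∈V ∘ suc))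

  tail-span : ∀ {k} (v : Vector Carrierᴹ (suc k)) {x} → x U.∈ Span (tail v) → x U.∈ Span v
  tail-span v (s , eq) = R.0# ∷ s ,
    ≈ᴹ-trans (+ᴹ-cong (*ₗ-zeroˡ _) eq) (+ᴹ-identityˡ _)

  head-span : ∀ {k} (v : Vector Carrierᴹ (suc k)) → v zero U.∈ Span v
  head-span v = R.1# ∷ (λ _ → R.0#) ,
    ≈ᴹ-trans (+ᴹ-cong (*ₗ-identityˡ _) (combination-0 (tail v))) (+ᴹ-identityʳ _)

  generator∈span : ∀ {k} (v : Vector Carrierᴹ k) i → v i U.∈ Span v
  generator∈span v zero    = head-span v
  generator∈span v (suc i) = tail-span v (generator∈span (tail v) i)

  span-⊆ : ∀ {k l} (v : Vector Carrierᴹ k) (w : Vector Carrierᴹ l) →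
           (∀ i → v i U.∈ Span w) → Span v U.⊆ Span w
  span-⊆ v w v∈w (s , eq) =
    IsSubspace.resp (span-isSubspace w) eq (combination-closed (span-isSubspace w) s v v∈w)

  independent-injective : ∀ {k} {v : Vector Carrierᴹ k} → LinearlyIndependent v →
                          ∀ s t → combination s v ≈ᴹ combination t v → ∀ i → s i R.≈ t i
  independent-injective {v = v} ind s t eq i =
    GroupProperties.x∙y⁻¹≈ε⇒x≈y R.+-abelianGroup _ _ (ind (λ i → s i R.- t i) (begin
      combination (λ i → s i R.- t i) v
        ≈⟨ combination-+ s (λ i → R.- t i) v ⟩
      combination s v +ᴹ combination (λ i → R.- t i) v
        ≈⟨ +ᴹ-cong eq ≈ᴹ-refl ⟩
      combination t v +ᴹ combination (λ i → R.- t i) v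
        ≈⟨ combination-+ t (λ i → R.- t i) v ⟨
      combination (λ i → t i R.- t i) v
        ≈⟨ combination-cong (λ i → R.-‿inverseʳ (t i)) ⟩
      combination (λ _ → R.0#) v
        ≈⟨ combination-0 v ⟩
      0ᴹ ∎) i)

  -- The witness of `generator∈span v j` is the j-th unit vector, so the sum picks out `s j`.
  generator∈span-coefficient : ∀ {k} (v : Vector Carrierᴹ k) j (s : Vector R.Carrier k) →
    R.sum (λ i → s i R.* proj₁ (generator∈span v j) i) R.≈ s j
  generator∈span-coefficient {suc k} v zero s = R.trans
    (R.+-cong (R.*-identityʳ _)
      (R.trans (R.sum-cong-≋ (λ i → R.zeroʳ (s (suc i)))) (R.sum-replicate-zero k)))
    (R.+-identityʳ _)
  generator∈span-coefficient {suc k} v (suc j) s = R.trans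
    (R.+-cong (R.zeroʳ _) (generator∈span-coefficient (tail v) j (tail s)))
    (R.+-identityˡ _)

map-combination : ∀ {r ℓr a ℓa b ℓb} {R : Ring r ℓr} (M : LeftModule R a ℓa) (N : LeftModule R b ℓb) →
                  let module M = LeftModule M; module N = LeftModule N in
                  (f : M.Carrierᴹ → N.Carrierᴹ) → f M.0ᴹ N.≈ᴹ N.0ᴹ →
                  (∀ x y → f (x M.+ᴹ y) N.≈ᴹ f x N.+ᴹ f y) →
                  (∀ s x → f (s M.*ₗ x) N.≈ᴹ s N.*ₗ f x) →
                  ∀ {k} s (v : Vector M.Carrierᴹ k) →
                  f (Linear.combination M s v) N.≈ᴹ Linear.combination N s (f ∘ v)
map-combination M N f f0 f+ f* {zero}  s v = f0
map-combination M N f f0 f+ f* {suc k} s v =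
  LeftModule.≈ᴹ-trans N (f+ _ _) (LeftModule.+ᴹ-cong N (f* _ _)
    (map-combination M N f f0 f+ f* (tail s) (tail v)))

-- Bases and dimensions over finite fields

module FiniteVectorSpace {c ℓ a ℓa} (K : Field c ℓ) {q} (card : HasCardinality K q)
                         (M : LeftModule (Field.ring K) a ℓa)
                         (_≟ᴹ_ : Decidable (LeftModule._≈ᴹ_ M)) where
  open LeftModule M
  open Linear M
  open LinearProperties M
  private module K = Field K
  open FiniteFieldProperties K card using (_≟_; 1<N)
  open ≈-Reasoning ≈ᴹ-setoid

  span? : ∀ {k} (v : Vector Carrierᴹ k) → U.Decidable (Span v)
  span? {k} v x = finite-any? (finite-^ card k)
    (λ s≈t eq → ≈ᴹ-trans (≈ᴹ-sym (combination-cong s≈t)) eq)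
    (λ s → combination s v ≟ᴹ x)

  independent-∷ : ∀ {k} {v : Vector Carrierᴹ k} {x} → LinearlyIndependent v →
                  ¬ x U.∈ Span v → LinearlyIndependent (x ∷ v)
  independent-∷ {v = v} {x} ind x∉v s eq with s zero ≟ K.0#
  ... | yes s₀≈0 = λ
    { zero    → s₀≈0
    ; (suc i) → ind (tail s) (begin
        combination (tail s) v                       ≈⟨ +ᴹ-identityˡ _ ⟨
        0ᴹ +ᴹ combination (tail s) v                 ≈⟨ +ᴹ-cong (*ₗ-zeroˡ x) ≈ᴹ-refl ⟨
        K.0# *ₗ x +ᴹ combination (tail s) v          ≈⟨ +ᴹ-cong (*ₗ-cong s₀≈0 ≈ᴹ-refl) ≈ᴹ-refl ⟨
        combination s (x ∷ v)                        ≈⟨ eq ⟩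
        0ᴹ                                           ∎) i }
  ... | no s₀≉0 = contradiction (IsSubspace.resp V s₀⁻¹s₀x≈x (IsSubspace.*-closed V s₀⁻¹ s₀x∈V)) x∉v
    where
    V = span-isSubspace v
    s₀⁻¹ = proj₁ (K.inverse (s zero) s₀≉0)
    s₀⁻¹s₀x≈x : s₀⁻¹ *ₗ (s zero *ₗ x) ≈ᴹ x
    s₀⁻¹s₀x≈x = ≈ᴹ-trans (≈ᴹ-sym (*ₗ-assoc _ _ x))
      (≈ᴹ-trans (*ₗ-cong (proj₁ (proj₂ (K.inverse (s zero) s₀≉0))) ≈ᴹ-refl) (*ₗ-identityˡ x))
    s₀x∈V : (s zero *ₗ x) U.∈ Span v
    s₀x∈V = IsSubspace.resp V (≈ᴹ-sym (begin
      s zero *ₗ x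
        ≈⟨ GroupProperties.inverseˡ-unique +ᴹ-abelianGroup _ _ eq ⟩
      -ᴹ combination (tail s) v
        ≈⟨ GroupProperties.inverseʳ-unique +ᴹ-abelianGroup _ _ (begin
             combination (tail s) v +ᴹ combination (λ i → K.- s (suc i)) v
               ≈⟨ combination-+ (tail s) (λ i → K.- s (suc i)) v ⟨
             combination (λ i → s (suc i) K.- s (suc i)) v
               ≈⟨ combination-cong (λ i → K.-‿inverseʳ (s (suc i))) ⟩
             combination (λ _ → K.0#) v
               ≈⟨ combination-0 v ⟩
             0ᴹ ∎) ⟨
      combination (λ i → K.- s (suc i)) v ∎)) ((λ i → K.- s (suc i)) , ≈ᴹ-refl)

  -- Greedy selection from the last generator to the first: a generator is kept only if `span?` does
  -- not find it in the span of those already kept.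
  span-basis : ∀ {k} (v : Vector Carrierᴹ k) → ∃ (HasDimension (Span v))
  span-basis {zero} v = 0 , v , record
    { members = λ () ; independent = λ _ _ () ; spanning = id }
  span-basis {suc k} v with span-basis (tail v)
  ... | r , b , basis with span? b (v zero)
  ...   | yes v₀∈b = r , b , record
    { members = tail-span v ∘ members
    ; independent = independent
    ; spanning = span-⊆ v b λ { zero → v₀∈b ; (suc i) → spanning (generator∈span (tail v) i) }
    }
    where open IsBasis basis
  ...   | no v₀∉b = suc r , v zero ∷ b , record
    { members = λ { zero → head-span v ; (suc i) → tail-span v (members i) }
    ; independent = independent-∷ independent v₀∉b
    ; spanning = span-⊆ v (v zero ∷ b) λ
        { zero    → head-span (v zero ∷ b)
        ; (suc i) → tail-span (v zero ∷ b) (spanning (generator∈span (tail v) i)) }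
    }
    where open IsBasis basis

  -- Coefficients over `w` determine the vector, which determines its coefficients over the
  -- independent `v`. So Kʳ injects into Kˢ, and counting takes the place of the exchange argument.
  independent⇒≤ : ∀ {r s} {v : Vector Carrierᴹ r} {w : Vector Carrierᴹ s} →
                  LinearlyIndependent v → (∀ i → v i U.∈ Span w) → r ≤ s
  independent⇒≤ {r} {s} {v} {w} ind v∈w =
    ^-cancelˡ-≤ 1<N (finite-injective⇒≤ (finite-^ card r) (finite-^ card s)
      (λ t → proj₁ (combination∈w t))
      (λ {t} {u} eq → independent-injective ind t u
        (≈ᴹ-trans (≈ᴹ-sym (proj₂ (combination∈w t)))
          (≈ᴹ-trans (combination-cong eq) (proj₂ (combination∈w u))))))
    where
    combination∈w : ∀ t → combination t v U.∈ Span w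
    combination∈w t = combination-closed (span-isSubspace w) t v v∈w

module CoordinateSpaceProperties {c ℓ} (K : Field c ℓ) {q} (card : HasCardinality K q) (n : ℕ) where
  open Field K using (ring; setoid)
  open LeftModule (coordinateSpace ring n)
  open Linear (coordinateSpace ring n)
  open LinearProperties (coordinateSpace ring n)
  open FiniteFieldProperties K card using (_≟_; 1<N)
  open ≈-Reasoning ≈ᴹ-setoid
  open FiniteVectorSpace K card (coordinateSpace ring n)
    (λ x y → Finₚ.all? (λ i → x i ≟ y i)) public

  -- By the pigeonhole principle (a, b) ↦ a·v + b·w takes some value twice, and a·v - a′·v = b′·w -
  -- b·w is the common vector. Were it zero, independence would identify the two pairs.
  spans-intersect : ∀ {r s} {v : Vector Carrierᴹ r} {w : Vector Carrierᴹ s} →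
                    LinearlyIndependent v → LinearlyIndependent w → n < r ℕ.+ s →
                    ∃[ x ] x U.∈ (Span v U.∩ Span w) × ¬ x ≈ᴹ 0ᴹ
  spans-intersect {r} {s} {v} {w} v-ind w-ind n<r+s
    with finite-pigeonhole (finite-× (finite-^ card r) (finite-^ card s)) (finite-^ card n)
           (λ (a , b) → combination a v +ᴹ combination b w)
           (subst (q ℕ.^ n <_) (ℕₚ.^-distribˡ-+-* q r s) (ℕₚ.^-monoʳ-< q 1<N n<r+s))
  ... | (a , b) , (a′ , b′) , distinct , eq =
    x , (((λ i → a i - a′ i) , difference a a′ v) , ((λ i → b′ i - b i) , ≈ᴹ-trans (difference b′ b w) (≈ᴹ-sym x≈))) ,
    λ x≈0 → distinct
      ( independent-injective v-ind a a′ (x-y≈0⇒x≈y _ _ x≈0)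
      , λ i → sym (independent-injective w-ind b′ b (x-y≈0⇒x≈y _ _ (≈ᴹ-trans (≈ᴹ-sym x≈) x≈0)) i))
    where
    open Field K using (_-_; sym; -‿inverseʳ; 0#)
    open GroupProperties +ᴹ-abelianGroup using (∙-cancelʳ; ∙-cancelˡ; //-rightDividesˡ)
      renaming (x∙y⁻¹≈ε⇒x≈y to x-y≈0⇒x≈y)
    x = combination a v +ᴹ -ᴹ combination a′ v

    difference : ∀ {k} a a′ (v : Vector Carrierᴹ k) →
                 combination (λ i → a i - a′ i) v ≈ᴹ combination a v +ᴹ -ᴹ combination a′ v
    difference a a′ v = ∙-cancelʳ (combination a′ v) _ _ (begin
      combination (λ i → a i - a′ i) v +ᴹ combination a′ v
        ≈⟨ combination-+ (λ i → a i - a′ i) a′ v ⟨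
      combination (λ i → (a i - a′ i) F+ a′ i) v
        ≈⟨ combination-cong (λ i → GroupProperties.//-rightDividesˡ (Field.+-abelianGroup K) (a′ i) (a i)) ⟩
      combination a v
        ≈⟨ //-rightDividesˡ _ _ ⟨
      combination a v +ᴹ -ᴹ combination a′ v +ᴹ combination a′ v ∎)
      where open Field K using () renaming (_+_ to _F+_)

    x≈ : x ≈ᴹ combination b′ w +ᴹ -ᴹ combination b w
    x≈ = ∙-cancelʳ (combination b w) _ _ (∙-cancelˡ (combination a′ v) _ _ (begin
      A′ +ᴹ (A +ᴹ -ᴹ A′ +ᴹ B)     ≈⟨ +ᴹ-assoc A′ _ B ⟨
      A′ +ᴹ (A +ᴹ -ᴹ A′) +ᴹ B     ≈⟨ +ᴹ-cong (+ᴹ-comm A′ _) ≈ᴹ-refl ⟩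
      A +ᴹ -ᴹ A′ +ᴹ A′ +ᴹ B       ≈⟨ +ᴹ-cong (//-rightDividesˡ A′ A) ≈ᴹ-refl ⟩
      A +ᴹ B                      ≈⟨ eq ⟩
      A′ +ᴹ B′                    ≈⟨ +ᴹ-cong ≈ᴹ-refl (//-rightDividesˡ B B′) ⟨
      A′ +ᴹ (B′ +ᴹ -ᴹ B +ᴹ B)     ∎))
      where
      A  = combination a v
      A′ = combination a′ v
      B  = combination b w
      B′ = combination b′ w

-- Skew polynomials

module SkewPolynomial {c ℓ} (R : CommutativeRing c ℓ) where
  open CommutativeRing R hiding (zero)
  open SemiringSum semiring
  open Solver commutativeSemiring using (solve; _:+_; _:*_; _:=_; con)
  open ≈-Reasoning setoid

  module Twisted (σ : Carrier → Carrier) (σ-cong : ∀ {x y} → x ≈ y → σ x ≈ σ y)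
                (σ-+ : ∀ x y → σ (x + y) ≈ σ x + σ y)
                (σ-* : ∀ x y → σ (x * y) ≈ σ x * σ y) where

    -- Applying `σ` innermost makes `skew a x` unfold to `a zero * x + skew (tail a) (σ x)`, the
    -- recursion on which the division runs.
    σ^ : ℕ → Carrier → Carrier
    σ^ zero    x = x
    σ^ (suc n) x = σ^ n (σ x)

    σ^-cong : ∀ n {x y} → x ≈ y → σ^ n x ≈ σ^ n y
    σ^-cong zero    x≈y = x≈y
    σ^-cong (suc n) x≈y = σ^-cong n (σ-cong x≈y)

    σ^-+ : ∀ n x y → σ^ n (x + y) ≈ σ^ n x + σ^ n y
    σ^-+ zero    x y = refl
    σ^-+ (suc n) x y = trans (σ^-cong n (σ-+ x y)) (σ^-+ n (σ x) (σ y))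

    σ^-* : ∀ n x y → σ^ n (x * y) ≈ σ^ n x * σ^ n y
    σ^-* zero    x y = refl
    σ^-* (suc n) x y = trans (σ^-cong n (σ-* x y)) (σ^-* n (σ x) (σ y))

    σ^-fixed : ∀ n {x} → σ x ≈ x → σ^ n x ≈ x
    σ^-fixed zero    σx≈x = refl
    σ^-fixed (suc n) σx≈x = trans (σ^-cong n σx≈x) (σ^-fixed n σx≈x)

    skew : ∀ {n} → Vector Carrier n → Carrier → Carrier
    skew a x = sum (λ i → a i * σ^ (toℕ i) x)

    skew-cong : ∀ {n} (a : Vector Carrier n) {x y} → x ≈ y → skew a x ≈ skew a y
    skew-cong {n} a x≈y = sum-cong-≋ {n} (λ i → *-congˡ (σ^-cong (toℕ i) x≈y))

    skew-+ : ∀ {n} (a : Vector Carrier n) x y → skew a (x + y) ≈ skew a x + skew a y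
    skew-+ a x y = trans
      (sum-cong-≋ (λ i → trans (*-congˡ (σ^-+ (toℕ i) x y)) (distribˡ (a i) _ _)))
      (∑-distrib-+ (λ i → a i * σ^ (toℕ i) x) (λ i → a i * σ^ (toℕ i) y))

    skew-*-fixed : ∀ {n} (a : Vector Carrier n) {t} x → σ t ≈ t → skew a (t * x) ≈ t * skew a x
    skew-*-fixed a {t} x σt≈t = trans
      (sum-cong-≋ (λ i → trans
        (*-congˡ (trans (σ^-* (toℕ i) t x) (*-congʳ (σ^-fixed (toℕ i) σt≈t))))
        (solve 3 (λ a t y → a :* (t :* y) := t :* (a :* y)) refl (a i) t (σ^ (toℕ i) x))))
      (sym (*-distribˡ-sum t (λ i → a i * σ^ (toℕ i) x)))

    -- Composition with multiplication by `u` is again a skew polynomial, with twisted coefficients.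
    skew-* : ∀ {n} (a : Vector Carrier n) u x →
             skew a (u * x) ≈ skew (λ i → a i * σ^ (toℕ i) u) x
    skew-* {n} a u x = sum-cong-≋ {n} (λ i → trans (*-congˡ (σ^-* (toℕ i) u x)) (sym (*-assoc _ _ _)))

    -- Right division by σ − 1; the remainder is the sum of the coefficients.
    skewQuotient : ∀ {n} → Vector Carrier (suc n) → Vector Carrier n
    skewQuotient {suc n} a zero    = sum (tail a)
    skewQuotient {suc n} a (suc i) = skewQuotient (tail a) i

    -- `d` stands for σ x - x, given by an equation so that only semiring identities are needed. The
    -- quotient's coefficient at σ^j is the sum of all `a i` with i > j, because σ^i - 1 = (1 + σ +
    -- ⋯ + σ^(i-1))(σ - 1).
    skew-quotient : ∀ {n} (a : Vector Carrier (suc n)) x d → σ x ≈ x + d →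
                    skew a x ≈ sum a * x + skew (skewQuotient a) d
    skew-quotient {zero} a x d σx≈x+d =
      solve 2 (λ a x → a :* x :+ con 0 := (a :+ con 0) :* x :+ con 0) refl (a zero) x
    skew-quotient {suc n} a x d σx≈x+d = begin
      a zero * x + skew (tail a) (σ x)
        ≈⟨ +-congˡ (skew-quotient (tail a) (σ x) (σ d) (trans (σ-cong σx≈x+d) (σ-+ x d))) ⟩
      a zero * x + (s * σ x + rest)
        ≈⟨ +-congˡ (+-congʳ (*-congˡ σx≈x+d)) ⟩
      a zero * x + (s * (x + d) + rest)
        ≈⟨ solve 5 (λ a x s d r → a :* x :+ (s :* (x :+ d) :+ r) := (a :+ s) :* x :+ (s :* d :+ r))
                 refl (a zero) x s d rest ⟩
      (a zero + s) * x + (s * d + rest) ∎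
      where
      s = sum (tail a)
      rest = skew (skewQuotient (tail a)) (σ d)

    skewQuotient≈0⇒≈0 : ∀ {n} (a : Vector Carrier (suc n)) → (∀ i → skewQuotient a i ≈ 0#) →
                        sum a ≈ 0# → ∀ i → a i ≈ 0#
    skewQuotient≈0⇒≈0 {zero} a q≈0 ∑a≈0 zero = trans (sym (+-identityʳ _)) ∑a≈0
    skewQuotient≈0⇒≈0 {suc n} a q≈0 ∑a≈0 zero =
      trans (sym (+-identityʳ _)) (trans (+-congˡ (sym (q≈0 zero))) ∑a≈0)
    skewQuotient≈0⇒≈0 {suc n} a q≈0 ∑a≈0 (suc i) =
      skewQuotient≈0⇒≈0 (tail a) (q≈0 ∘ suc) (q≈0 zero) i

-- Finite field extensions

module ExtensionProperties {q m c₁ ℓ₁ c₂ ℓ₂} (X : FiniteFieldExtension q m c₁ ℓ₁ c₂ ℓ₂)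
                           p e (p-prime : Prime p) (q≡p^e : q ≡ p ℕ.^ e)
                           (Γ : FiniteFieldExtension.Basis X) where
  open FiniteFieldExtension X
  open IsRingHomomorphism ι-isHomomorphism using (⟦⟧-cong; +-homo; *-homo; 0#-homo; 1#-homo; -‿homo)
  private
    module FF = FiniteFieldProperties F F-cardinality
    module EE = FiniteFieldProperties E E-cardinality
  open E using (_≈_; _+_; _*_; _-_; 0#; 1#)
  open Exp E.commutativeSemiring using (_^_; ^-congˡ; ^-distrib-*)
  open Exp F.commutativeSemiring using () renaming (_^_ to _^F_)
  open ≈-Reasoning E.setoid

  σ : E.Carrier → E.Carrier
  σ x = x ^ q

  σ-cong : ∀ {x y} → x ≈ y → σ x ≈ σ y
  σ-cong = ^-congˡ q

  σ-* : ∀ x y → σ (x * y) ≈ σ x * σ y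
  σ-* x y = ^-distrib-* x y q

  σ-+ : ∀ x y → σ (x + y) ≈ σ x + σ y
  σ-+ x y = subst (λ q → (x + y) ^ q ≈ x ^ q + y ^ q) (≡.sym q≡p^e)
    (Characteristic.^[p^e]-homo-+ E.commutativeRing p-prime p·1≈0 e x y)
    where
    -- E has q^m = p^(e m) elements, so its characteristic is `p` as well.
    p·1≈0 = EE.p·1≈0 p (e ℕ.* m) (≡.trans (cong (ℕ._^ m) q≡p^e) (ℕₚ.^-*-assoc p e m))

  ι-^ : ∀ t n → ι (t ^F n) ≈ ι t ^ n
  ι-^ t zero    = 1#-homo
  ι-^ t (suc n) = E.trans (*-homo t _) (E.*-congˡ (ι-^ t n))

  σ-ι : ∀ t → σ (ι t) ≈ ι t
  σ-ι t = E.trans (E.sym (ι-^ t q)) (⟦⟧-cong (FF.x^N≈x t))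

  σ-1 : σ 1# ≈ 1#
  σ-1 = E.trans (σ-cong (E.sym 1#-homo)) (E.trans (σ-ι F.1#) 1#-homo)

  ι≈0⇒≈0 : ∀ {t} → ι t ≈ 0# → t F.≈ F.0#
  ι≈0⇒≈0 {t} ιt≈0 = decidable-stable (t FF.≟ F.0#) λ t≉0 →
    let t⁻¹ , t⁻¹t≈1 , _ = F.inverse t t≉0 in
    E.1≉0 (begin
      1#                 ≈⟨ 1#-homo ⟨
      ι F.1#             ≈⟨ ⟦⟧-cong t⁻¹t≈1 ⟨
      ι (t⁻¹ F.* t)      ≈⟨ *-homo t⁻¹ t ⟩
      ι t⁻¹ * ι t        ≈⟨ E.*-congˡ ιt≈0 ⟩
      ι t⁻¹ * 0#         ≈⟨ E.zeroʳ _ ⟩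
      0#                 ∎)

  ι-injective : ∀ {s t} → ι s ≈ ι t → s F.≈ t
  ι-injective {s} {t} ιs≈ιt = FF.x-y≈0⇒x≈y s t (ι≈0⇒≈0 (begin
    ι (s F.- t)       ≈⟨ +-homo s (F.- t) ⟩
    ι s + ι (F.- t)   ≈⟨ E.+-cong ιs≈ιt (-‿homo t) ⟩
    ι t - ι t         ≈⟨ E.-‿inverseʳ (ι t) ⟩
    0#                ∎))

  -- The image of `ι` already supplies q fixed points; one outside it would be a root number q + 1
  -- of X^q - X.
  σ-fixed : ∀ {x} → σ x ≈ x → ∃[ t ] ι t ≈ x
  σ-fixed {x} σx≈x
    with finite-any? F-cardinality (λ s≈t → E.trans (⟦⟧-cong (F.sym s≈t))) (λ t → ι t EE.≟ x)
  ... | yes t∈F = t∈F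
  ... | no  x∉F = contradiction
    (λ { zero → σx≈x ; (suc i) → σ-ι _ })
    (EE.fixed-by-power-bound FF.1<N (x ∷ (ι ∘ from)) λ
      { zero    zero    _  → ≡.refl
      ; zero    (suc j) eq → contradiction (from j , E.sym eq) x∉F
      ; (suc i) zero    eq → contradiction (from i , eq) x∉F
      ; (suc i) (suc j) eq → cong suc (from-injective F-cardinality (ι-injective eq)) })
    where open Inverse F-cardinality using (from)

  open SkewPolynomial.Twisted E.commutativeRing σ σ-cong σ-+ σ-* public

  -- Coordinates

  open RankMetric X Γ using (coordinates)
  open LinearProperties E-over-F using (independent-injective; combination-+; combination-*; combination-0)
  private
    Γ-basis = proj₂ Γ
    γ = proj₁ Γ
  open Linear E-over-F using (combination)

  combination-coordinates : ∀ x → combination (coordinates x) γ ≈ x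
  combination-coordinates x = proj₂ (Linear.IsBasis.spanning Γ-basis {x} tt)

  -- `coordinates` is read off a spanning proof and need not respect `_≈_` by construction.
  -- Congruence and F-linearity both come from this uniqueness.
  coordinates-unique : ∀ {x} s → combination s γ ≈ x → ∀ i → coordinates x i F.≈ s i
  coordinates-unique {x} s eq =
    independent-injective (Linear.IsBasis.independent Γ-basis) (coordinates x) s
      (E.trans (combination-coordinates x) (E.sym eq))

  coordinates-cong : ∀ {x y} → x ≈ y → ∀ i → coordinates x i F.≈ coordinates y i
  coordinates-cong {x} {y} x≈y =
    coordinates-unique (coordinates y) (E.trans (combination-coordinates y) (E.sym x≈y))

  coordinates-injective : ∀ {x y} → (∀ i → coordinates x i F.≈ coordinates y i) → x ≈ y
  coordinates-injective {x} {y} eq = begin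
    x                              ≈⟨ combination-coordinates x ⟨
    combination (coordinates x) γ  ≈⟨ LinearProperties.combination-cong E-over-F eq ⟩
    combination (coordinates y) γ  ≈⟨ combination-coordinates y ⟩
    y                              ∎

  coordinates-+ : ∀ x y i → coordinates (x + y) i F.≈ coordinates x i F.+ coordinates y i
  coordinates-+ x y = coordinates-unique _
    (E.trans (combination-+ (coordinates x) (coordinates y) γ)
      (E.+-cong (combination-coordinates x) (combination-coordinates y)))

  coordinates-* : ∀ t x i → coordinates (ι t * x) i F.≈ t F.* coordinates x i
  coordinates-* t x = coordinates-unique _
    (E.trans (combination-* t (coordinates x) γ) (E.*-congˡ (combination-coordinates x)))

  coordinates-0 : ∀ i → coordinates 0# i F.≈ F.0#
  coordinates-0 = coordinates-unique _ (combination-0 γ)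

  -- Some coordinate of 1 is nonzero. Adding `ι t` shifts that coordinate by `t` times a nonzero
  -- constant, so it separates the points of any coset of F in E.
  coset-separating : ∃[ g ] (∀ t {x y} → x ≈ ι t + y → g x F.≈ g y → x ≈ y)
  coset-separating with Finₚ.¬∀⟶∃¬ m _ (λ i → coordinates 1# i FF.≟ F.0#) 1-coordinates≉0
    where
    1-coordinates≉0 : ¬ (∀ i → coordinates 1# i F.≈ F.0#)
    1-coordinates≉0 all≈0 = E.1≉0
      (coordinates-injective (λ i → F.trans (all≈0 i) (F.sym (coordinates-0 i))))
  ... | j , 1ⱼ≉0 = (λ x → coordinates x j) , separates
    where
    separates : ∀ t {x y} → x ≈ ι t + y → coordinates x j F.≈ coordinates y j → x ≈ y
    separates t {x} {y} x≈t+y xⱼ≈yⱼ = begin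
      x          ≈⟨ x≈t+y ⟩
      ι t + y    ≈⟨ E.+-congʳ (E.trans (⟦⟧-cong t≈0) 0#-homo) ⟩
      0# + y     ≈⟨ E.+-identityˡ y ⟩
      y          ∎
      where
      t*1ⱼ≈0 : t F.* coordinates 1# j F.≈ F.0#
      t*1ⱼ≈0 = GroupProperties.identityˡ-unique F.+-abelianGroup _ (coordinates y j)
        (F.trans (F.+-congʳ (F.sym (coordinates-* t 1# j)))
        (F.trans (F.sym (coordinates-+ (ι t * 1#) y j))
        (F.trans (coordinates-cong (E.trans (E.+-congʳ (E.*-identityʳ (ι t))) (E.sym x≈t+y)) j) xⱼ≈yⱼ)))
      t≈0 : t F.≈ F.0#
      t≈0 = FF.x*y≈0⇒y≈0 1ⱼ≉0 (F.trans (F.*-comm _ t) t*1ⱼ≈0)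

-- Fibres of skew polynomials and the rank bound

module RankBound {q m c₁ ℓ₁ c₂ ℓ₂} (X : FiniteFieldExtension q m c₁ ℓ₁ c₂ ℓ₂)
                 p e (p-prime : Prime p) (q≡p^e : q ≡ p ℕ.^ e)
                 (Γ : FiniteFieldExtension.Basis X) where
  open FiniteFieldExtension X
  open ExtensionProperties X p e p-prime q≡p^e Γ
  open RankMetric X Γ using (coordinates; Mat)
  private
    module FF = FiniteFieldProperties F F-cardinality
    module EE = FiniteFieldProperties E E-cardinality
    module ∑F = SemiringSum F.semiring
    γ = proj₁ Γ
  open E using (_≈_; _+_; _*_; _-_; 0#; 1#)
  open ≈-Reasoning E.setoid

  skew-fibre-difference : ∀ {n} (a : Vector E.Carrier n) {x y} → skew a x ≈ skew a y → skew a (x - y) ≈ 0#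
  skew-fibre-difference a {x} {y} eq = GroupProperties.identityˡ-unique E.+-abelianGroup _ (skew a y) (begin
    skew a (x - y) + skew a y  ≈⟨ skew-+ a (x - y) y ⟨
    skew a (x - y + y)         ≈⟨ skew-cong a (GroupProperties.//-rightDividesˡ E.+-abelianGroup y x) ⟩
    skew a x                   ≈⟨ eq ⟩
    skew a y                   ∎)

  σ^≉0 : ∀ n {u} → ¬ u ≈ 0# → ¬ σ^ n u ≈ 0#
  σ^≉0 n {u} u≉0 σu≈0 = let u⁻¹ , u⁻¹u≈1 , _ = E.inverse u u≉0 in E.1≉0 (begin
    1#                   ≈⟨ σ^-fixed n σ-1 ⟨
    σ^ n 1#              ≈⟨ σ^-cong n u⁻¹u≈1 ⟨
    σ^ n (u⁻¹ * u)       ≈⟨ σ^-* n u⁻¹ u ⟩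
    σ^ n u⁻¹ * σ^ n u    ≈⟨ E.*-congˡ σu≈0 ⟩
    σ^ n u⁻¹ * 0#        ≈⟨ E.zeroʳ _ ⟩
    0#                   ∎)

  σ-difference : ∀ x → σ x ≈ x + (σ x - x)
  σ-difference x = E.sym (E.trans (E.+-comm x _)
    (GroupProperties.//-rightDividesˡ E.+-abelianGroup x (σ x)))

  -- A nonzero skew polynomial of degree at most n has a kernel of dimension at
  -- most n: on each of its fibres, n coordinates over F tell the points apart.
  -- A kernel vector u lets one substitute u x for x, after which σ − 1 can be
  -- divided out; this costs one coordinate, because the kernel of σ − 1 is F.
  skew-fibres : ∀ {n} (a : Vector E.Carrier (suc n)) → ¬ (∀ i → a i ≈ 0#) →
    ∃[ κ ] (∀ x y → skew a x ≈ skew a y →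
            (∀ (i : Fin n) → κ x i F.≈ κ y i) → x ≈ y)
  skew-fibres {n} a a≉0
    with finite-any? E-cardinality
           {P = λ u → ¬ u ≈ 0# × skew a u ≈ 0#}
           (λ x≈y (x≉0 , ax≈0) → (λ y≈0 → x≉0 (E.trans x≈y y≈0)) ,
                                 E.trans (skew-cong a (E.sym x≈y)) ax≈0)
           (λ u → ¬? (u EE.≟ 0#) ×-dec (skew a u EE.≟ 0#))
  -- Differences inside a fibre lie in the kernel, so each fibre is a single point and constant
  -- coordinates suffice.
  ... | no trivial-kernel = (λ _ _ → F.0#) , λ x y ax≈ay _ →
    EE.x-y≈0⇒x≈y x y (decidable-stable (x - y EE.≟ 0#) (λ x-y≉0 →
      trivial-kernel (x - y , x-y≉0 , skew-fibre-difference a ax≈ay)))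
  skew-fibres {zero} a a≉0 | yes (u , u≉0 , au≈0) = contradiction
    (λ { zero → EE.x*y≈0⇒y≈0 u≉0 (E.trans (E.*-comm u _) (E.trans (E.sym (E.+-identityʳ _)) au≈0)) })
    a≉0
  skew-fibres {suc n} a a≉0 | yes (u , u≉0 , au≈0) =
    -- The inductive coordinates recover `δ x′`, hence `x′` up to an element of F; `g` removes this
    -- last ambiguity.
    (λ x → g (u⁻¹ * x) ∷ κ (δ (u⁻¹ * x))) , λ x y ax≈ay κx≈κy →
      let x′ = u⁻¹ * x ; y′ = u⁻¹ * y
          δx′≈δy′ = κ-separates (δ x′) (δ y′)
            (E.trans (E.sym (divided x)) (E.trans ax≈ay (divided y))) (κx≈κy ∘ suc)
          t , t≈x′-y′ = σ-fixed (σ-fixes-difference δx′≈δy′)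
      in EE.*-cancelˡ-≉0 u⁻¹≉0 (g-separates t (begin
           x′              ≈⟨ GroupProperties.//-rightDividesˡ E.+-abelianGroup y′ x′ ⟨
           x′ - y′ + y′    ≈⟨ E.+-congʳ t≈x′-y′ ⟨
           ι t + y′        ∎) (κx≈κy zero))
    where
    u⁻¹ = proj₁ (E.inverse u u≉0)
    uu⁻¹≈1 = proj₂ (proj₂ (E.inverse u u≉0))
    u⁻¹≉0 : ¬ u⁻¹ ≈ 0#
    u⁻¹≉0 u⁻¹≈0 = E.1≉0 (E.trans (E.sym uu⁻¹≈1) (E.trans (E.*-congˡ u⁻¹≈0) (E.zeroʳ u)))
    δ : E.Carrier → E.Carrier
    δ x = σ x - x
    b : Vector E.Carrier (2 ℕ.+ n)
    b i = a i * σ^ (toℕ i) u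
    quotient≉0 : ¬ (∀ i → skewQuotient b i ≈ 0#)
    -- The remainder `sum b` is `skew a u` by definition, so `au≈0` says that it vanishes. With a
    -- zero quotient `b` would be zero, and so would `a`, the powers of `σ` being nonzero at `u`.
    quotient≉0 quotient≈0 = a≉0 (λ i → EE.x*y≈0⇒y≈0 (σ^≉0 (toℕ i) u≉0)
      (E.trans (E.*-comm _ (a i)) (skewQuotient≈0⇒≈0 b quotient≈0 au≈0 i)))
    IH = skew-fibres (skewQuotient b) quotient≉0
    κ = proj₁ IH
    κ-separates = proj₂ IH
    g = proj₁ coset-separating
    g-separates = proj₂ coset-separating
    divided : ∀ x → skew a x ≈ skew (skewQuotient b) (δ (u⁻¹ * x))
    divided x = let x′ = u⁻¹ * x in begin
      skew a x                                  ≈⟨ skew-cong a (E.*-identityˡ x) ⟨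
      skew a (1# * x)                           ≈⟨ skew-cong a (E.*-congʳ uu⁻¹≈1) ⟨
      skew a ((u * u⁻¹) * x)                    ≈⟨ skew-cong a (E.*-assoc u u⁻¹ x) ⟩
      skew a (u * x′)                           ≈⟨ skew-* a u x′ ⟩
      skew b x′                                 ≈⟨ skew-quotient b x′ (δ x′) (σ-difference x′) ⟩
      skew a u * x′ + skew (skewQuotient b) (δ x′)  ≈⟨ E.+-congʳ (E.trans (E.*-congʳ au≈0) (E.zeroˡ x′)) ⟩
      0# + skew (skewQuotient b) (δ x′)         ≈⟨ E.+-identityˡ _ ⟩
      skew (skewQuotient b) (δ x′)              ∎
    σ-fixes-difference : ∀ {x y} → δ x ≈ δ y → σ (x - y) ≈ x - y
    σ-fixes-difference {x} {y} δx≈δy =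
      GroupProperties.∙-cancelʳ E.+-abelianGroup (σ y) _ _ (begin
        σ (x - y) + σ y      ≈⟨ σ-+ (x - y) y ⟨
        σ (x - y + y)        ≈⟨ σ-cong (GroupProperties.//-rightDividesˡ E.+-abelianGroup y x) ⟩
        σ x                  ≈⟨ σ-difference x ⟩
        x + δ x              ≈⟨ E.+-cong (E.sym (GroupProperties.//-rightDividesˡ E.+-abelianGroup y x)) δx≈δy ⟩
        x - y + y + δ y      ≈⟨ E.+-assoc _ y _ ⟩
        x - y + (y + δ y)    ≈⟨ E.+-congˡ (σ-difference y) ⟨
        x - y + σ y          ∎)

  -- `skew a` is F-linear because `σ` fixes `ι t`; each coordinate of it is therefore a functional,
  -- determined by its values on the basis.
  coordinates-skew : ∀ {n} (a : Vector E.Carrier n) x i →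
    coordinates (skew a x) i F.≈ ∑F.sum (λ j → coordinates x j F.* coordinates (skew a (γ j)) i)
  coordinates-skew a x i = F.trans
    (coordinates-cong (skew-cong a (E.sym (combination-coordinates x))) i)
    (map-combination E-over-F leftModule (λ x → coordinates (skew a x) i)
      (F.trans (coordinates-cong skew-0 i) (coordinates-0 i))
      (λ x y → F.trans (coordinates-cong (skew-+ a x y) i) (coordinates-+ _ _ i))
      (λ t x → F.trans (coordinates-cong (skew-*-fixed a x (σ-ι t)) i) (coordinates-* t _ i))
      (coordinates x) γ)
    where
    skew-0 : skew a 0# ≈ 0#
    skew-0 = E.trans (skew-cong a (E.sym (E.-‿inverseʳ 0#))) (skew-fibre-difference a E.refl)

  combination-lookup : ∀ {c ℓ} (R : Ring c ℓ) {n k} s (v : Vector (Vector (Ring.Carrier R) n) k) j →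
    Linear.combination (coordinateSpace R n) s v j ≡
    MonoidSum.sum (Ring.+-commutativeMonoid R) (λ i → Ring._*_ R (s i) (v i j))
  combination-lookup R {k = zero}  s v j = ≡.refl
  combination-lookup R {k = suc k} s v j =
    cong (Ring._+_ R _) (combination-lookup R (tail s) (tail v) j)

  -- The rows are combinations of `w`, so the `r` numbers `pairing x l` determine all coordinates of
  -- `skew a x`; `κ x` then singles out `x` in its fibre. The family `w` need not be independent nor
  -- lie in the support, which also permits `r = 0`.
  skew-rank-bound : ∀ {k n r} (a : Vector E.Carrier (suc k)) → ¬ (∀ i → a i ≈ 0#) →
    (c : Vector E.Carrier (m ℕ.+ n)) → (∀ j → c (j Fin.↑ˡ n) ≈ skew a (γ j)) →
    (w : Vector (Vector F.Carrier (m ℕ.+ n)) r) →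
    (∀ i → Linear.Span (coordinateSpace F.ring (m ℕ.+ n)) w (Mat c i)) → m ≤ r ℕ.+ k
  skew-rank-bound {k} {n} {r} a a≉0 c c≈ w Mat∈w =
    ^-cancelˡ-≤ FF.1<N (subst (q ℕ.^ m ≤_) (≡.sym (ℕₚ.^-distribˡ-+-* q r k))
      (finite-injective⇒≤ E-cardinality (finite-× (finite-^ F-cardinality r) (finite-^ F-cardinality k))
        (λ x → pairing x , κ x)
        (λ {x} {y} (eq , κ-eq) → κ-separates x y (coordinates-injective (λ i →
          F.trans (coordinates≈ x i) (F.trans
            (∑F.sum-cong-≋ (λ l → F.*-congˡ (eq l))) (F.sym (coordinates≈ y i))))) κ-eq)))
    where
    κ = proj₁ (skew-fibres a a≉0)
    κ-separates = proj₂ (skew-fibres a a≉0)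
    pairing : E.Carrier → Vector F.Carrier r
    pairing x l = ∑F.sum (λ j → coordinates x j F.* w l (j Fin.↑ˡ n))
    module F≈ = ≈-Reasoning F.setoid
    entry : ∀ i j → coordinates (skew a (γ j)) i F.≈
                    ∑F.sum (λ l → proj₁ (Mat∈w i) l F.* w l (j Fin.↑ˡ n))
    entry i j = F.trans (coordinates-cong (E.sym (c≈ j)) i)
      (F.trans (F.sym (proj₂ (Mat∈w i) (j Fin.↑ˡ n)))
        (F.reflexive (combination-lookup F.ring (proj₁ (Mat∈w i)) w (j Fin.↑ˡ n))))
    coordinates≈ : ∀ x i → coordinates (skew a x) i F.≈
                   ∑F.sum (λ l → proj₁ (Mat∈w i) l F.* pairing x l)
    coordinates≈ x i = F≈.begin
      coordinates (skew a x) i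
        F≈.≈⟨ coordinates-skew a x i ⟩
      ∑F.sum (λ j → t j F.* coordinates (skew a (γ j)) i)
        F≈.≈⟨ ∑F.sum-cong-≋ (λ j → F.*-congˡ (entry i j)) ⟩
      ∑F.sum (λ j → t j F.* ∑F.sum (λ l → s l F.* w l (j Fin.↑ˡ n)))
        F≈.≈⟨ ∑F.sum-cong-≋ (λ j → ∑F.*-distribˡ-sum {r} (t j) _) ⟩
      ∑F.sum (λ j → ∑F.sum (λ l → t j F.* (s l F.* w l (j Fin.↑ˡ n))))
        F≈.≈⟨ ∑F.∑-comm (λ j l → t j F.* (s l F.* w l (j Fin.↑ˡ n))) ⟩
      ∑F.sum (λ l → ∑F.sum (λ j → t j F.* (s l F.* w l (j Fin.↑ˡ n))))
        F≈.≈⟨ ∑F.sum-cong-≋ (λ l → ∑F.sum-cong-≋ (λ j →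
               solve 3 (λ t s w → t :* (s :* w) := s :* (t :* w)) F.refl (t j) (s l) (w l (j Fin.↑ˡ n)))) ⟩
      ∑F.sum (λ l → ∑F.sum (λ j → s l F.* (t j F.* w l (j Fin.↑ˡ n))))
        F≈.≈⟨ ∑F.sum-cong-≋ (λ l → ∑F.*-distribˡ-sum {m} (s l) _) ⟨
      ∑F.sum (λ l → s l F.* pairing x l) F≈.∎
      where
      open Solver F.commutativeSemiring using (solve; _:*_; _:=_)
      t = coordinates x
      s = proj₁ (Mat∈w i)

-- The code

module ExtendedGabidulin {q m c₁ ℓ₁ c₂ ℓ₂} (X : FiniteFieldExtension q m c₁ ℓ₁ c₂ ℓ₂)
                         p e (p-prime : Prime p) (q≡p^e : q ≡ p ℕ.^ e)
                         (Γ : FiniteFieldExtension.Basis X)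
                         (k n′ : ℕ) (n′≤m : n′ ≤ m) (k+2≤m : 2 ℕ.+ k ≤ m)
                         (n+2k≤2m+1 : m ℕ.+ n′ ℕ.+ 2 ℕ.* (2 ℕ.+ k) ≤ 2 ℕ.* m ℕ.+ 1) where
  open FiniteFieldExtension X
  open ExtensionProperties X p e p-prime q≡p^e Γ
  open RankBound X p e p-prime q≡p^e Γ
  open RankMetric X Γ
  private
    n = m ℕ.+ n′
    module FF = FiniteFieldProperties F F-cardinality
    module EE = FiniteFieldProperties E E-cardinality
    module ∑F = SemiringSum F.semiring
    module ∑E = SemiringSum E.semiring
    module Fⁿ = CoordinateSpaceProperties F F-cardinality n
    module LFP = LinearProperties (coordinateSpace F.ring n)
    module LEP = LinearProperties (coordinateSpace E.ring n)
    module LF = Linear (coordinateSpace F.ring n)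
    module LE = Linear (coordinateSpace E.ring n)
    γ = proj₁ Γ
  open E using (_≈_; 0#; 1#)

  -- The rank bound reads only the first `m` entries, so these additions cannot spoil it.
  extra : Fin (2 ℕ.+ k) → Vector E.Carrier n′
  extra (suc zero) j = γ (Fin.inject≤ j n′≤m)
  extra _          j = 0#

  generator : Vector (Vector E.Carrier n) (2 ℕ.+ k)
  generator i = (λ j → σ^ (toℕ i) (γ j)) ++ extra i

  encode : Vector E.Carrier (2 ℕ.+ k) → Vector E.Carrier n
  encode a = LE.combination a generator

  encode-↑ˡ : ∀ a j → encode a (j Fin.↑ˡ n′) ≈ skew a (γ j)
  encode-↑ˡ a j = E.trans (E.reflexive (combination-lookup E.ring a generator (j Fin.↑ˡ n′)))
    (∑E.sum-cong-≋ (λ i → E.*-congˡ {a i} (E.reflexive (lookup-++ˡ (λ j → σ^ (toℕ i) (γ j)) (extra i) j))))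

  -- A nonzero message with zero codeword would have its matrix rows spanned by the empty family, so
  -- the rank bound would give `m ≤ suc k`.
  generator-independent : LE.LinearlyIndependent generator
  generator-independent a encode≈0 = decidable-stable (Finₚ.all? (λ i → a i EE.≟ 0#)) λ a≉0 →
    ℕₚ.<⇒≱ k+2≤m (skew-rank-bound {n = n′} {r = 0} a a≉0 (λ _ → 0#)
      (λ j → E.trans (E.sym (encode≈0 (j Fin.↑ˡ n′))) (encode-↑ˡ a j))
      (λ ()) (λ i → (λ ()) , λ j → F.sym (coordinates-0 i)))

  HasRank⇒≥ : ∀ a {r} → ¬ (∀ j → encode a j ≈ 0#) → HasRank (encode a) r → m ≤ r ℕ.+ suc k
  HasRank⇒≥ a c≉0 (w , w-basis) = skew-rank-bound a
    (λ a≈0 → c≉0 (λ j → E.trans (LEP.combination-cong {v = generator} a≈0 j) (LEP.combination-0 generator j)))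
    (encode a) (encode-↑ˡ a) w
    (λ i → LF.IsBasis.spanning w-basis (LFP.generator∈span (Mat (encode a)) i))

  -- The minimum is taken over enumerated messages, whereas a codeword is given only up to `_≈_`;
  -- this carries the rank across.
  HasRank-≤ : ∀ {c c′ r r′} → (∀ j → c j ≈ c′ j) → HasRank c r → HasRank c′ r′ → r ≤ r′
  HasRank-≤ {c} {c′} c≈c′ (v , v-basis) (w , w-basis) =
    Fⁿ.independent⇒≤ (V.independent) (λ i →
      W.spanning (LFP.span-⊆ (Mat c) (Mat c′) row∈ (V.members i)))
    where
    module V = LF.IsBasis v-basis
    module W = LF.IsBasis w-basis
    row∈ : ∀ i → Mat c i U.∈ LF.Span (Mat c′)
    row∈ i = LF.IsSubspace.resp (LFP.span-isSubspace (Mat c′))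
      (λ j → coordinates-cong (E.sym (c≈c′ j)) i) (LFP.generator∈span (Mat c′) i)

  private
    messages : Finite (≋-setoid E.setoid (2 ℕ.+ k)) ((q ℕ.^ m) ℕ.^ (2 ℕ.+ k))
    messages = finite-^ E-cardinality (2 ℕ.+ k)
    module messages = Inverse messages

    word : Fin ((q ℕ.^ m) ℕ.^ (2 ℕ.+ k)) → Vector E.Carrier n
    word x = encode (messages.from x)

    word-to : ∀ a j → word (messages.to a) j ≈ encode a j
    word-to a = LEP.combination-cong {v = generator} (from-to messages a)

    rank : ∀ (c : Vector E.Carrier n) → ∃ (HasRank c)
    rank c = Fⁿ.span-basis (Mat c)

    1∷0 : Vector E.Carrier (2 ℕ.+ k)
    1∷0 = 1# ∷ λ _ → 0#

    minimal = argmin (λ x → ¬? (Finₚ.all? (λ j → word x j EE.≟ 0#)))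
      (λ x → proj₁ (rank (word x)))
      -- The search needs one nonzero codeword: the message (1, 0, ..., 0) gives one, as the
      -- generators are independent.
      (messages.to 1∷0 , λ word≈0 → E.1≉0 (generator-independent 1∷0
        (λ j → E.trans (E.sym (word-to 1∷0 j)) (word≈0 j)) zero))

    x₀ = proj₁ minimal
    x₀≉0 = proj₁ (proj₂ minimal)
    d = proj₁ (rank (word x₀))

  code : Code n (2 ℕ.+ k) d
  code = record
    { codewords       = LE.Span generator
    ; isSubspace      = LEP.span-isSubspace generator
    ; 1≤k             = s≤s z≤n
    ; dimension       = generator , record
      { members = LEP.generator∈span generator ; independent = generator-independent ; spanning = id }
    ; minimumDistance = record
      { attained   = word x₀ , ((messages.from x₀ , λ _ → E.refl) , x₀≉0) , proj₂ (rank (word x₀))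
      ; lowerBound = λ c r ((a , eq) , c≉0) c-rank →
          let word≈c = λ j → E.trans (word-to a j) (eq j) in
          ℕₚ.≤-trans
            (proj₂ (proj₂ minimal) (messages.to a)
              (λ word≈0 → c≉0 (λ j → E.trans (E.sym (word≈c j)) (word≈0 j))))
            (HasRank-≤ word≈c (proj₂ (rank _)) c-rank)
      }
    }

  n<2d : n < 2 ℕ.* d
  n<2d = distance-bound {m} {suc k} {n} {d} n+2k≤2m+1 (HasRank⇒≥ (messages.from x₀) x₀≉0 (proj₂ (rank (word x₀))))

  intersecting : Intersecting code
  intersecting c c′ c∈ c′∈ with rank c | rank c′
  ... | r , w , w-basis | r′ , w′ , w′-basis =
    let x , (x∈w , x∈w′) , x≉0 = Fⁿ.spans-intersect W.independent W′.independent n<r+r′ in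
    x , (LFP.span-⊆ w (Mat c) W.members x∈w , LFP.span-⊆ w′ (Mat c′) W′.members x∈w′) , x≉0
    where
    module W = LF.IsBasis w-basis
    module W′ = LF.IsBasis w′-basis
    open IsMinimumDistance (Code.minimumDistance code)
    n<r+r′ : n < r ℕ.+ r′
    n<r+r′ = ℕₚ.<-≤-trans n<2d (ℕₚ.≤-trans
      (ℕₚ.≤-reflexive (cong (d ℕ.+_) (ℕₚ.+-identityʳ d)))
      (ℕₚ.+-mono-≤ (lowerBound c r c∈ (w , w-basis)) (lowerBound c′ r′ c′∈ (w′ , w′-basis))))

  -- The functional on E with value `s i` at the i-th element of `Γ`. Combining the rows of `Mat c`
  -- with coefficients `s` applies it to every entry of `c`.
  pairing : Vector F.Carrier m → E.Carrier → F.Carrier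
  pairing s x = ∑F.sum (λ i → s i F.* coordinates x i)

  pairing-γ : ∀ s j → pairing s (γ j) F.≈ s j
  pairing-γ s j = F.trans
    (∑F.sum-cong-≋ (λ i → F.*-congˡ (coordinates-unique _ (proj₂ (LinearProperties.generator∈span E-over-F γ j)) i)))
    (LinearProperties.generator∈span-coefficient E-over-F γ j s)

  pairing-0 : ∀ s → pairing s 0# F.≈ F.0#
  pairing-0 s = F.trans
    (∑F.sum-cong-≋ (λ i → F.trans (F.*-congˡ (coordinates-0 i)) (F.zeroʳ (s i))))
    (∑F.sum-replicate-zero m)

  combination-Mat : ∀ s (c : Vector E.Carrier n) j {x} → c j ≡ x →
                    LF.combination s (Mat c) j F.≈ pairing s x
  combination-Mat s c j ≡.refl = F.reflexive (combination-lookup F.ring s (Mat c) j)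

  -- The supports of the first two generators already sum to Fⁿ.  The first
  -- one is (Γ, 0), whose matrix is (I | 0); the second one ends in an initial
  -- segment of Γ.
  nondegenerate : Nondegenerate code
  nondegenerate v =
    2 , (λ { zero → row zero ; (suc zero) → row (suc zero) }) ,
    (λ { zero → w₀ ; (suc zero) → w₁ }) ,
    (λ { zero → s₀ , λ _ → F.refl ; (suc zero) → s₁ , λ _ → F.refl }) ,
    ↑-elim m n′ (λ j → w₀ j F.+ (w₁ j F.+ F.0#) F.≈ v j)
      (λ j → begin
        w₀ (j Fin.↑ˡ n′) F.+ (w₁ (j Fin.↑ˡ n′) F.+ F.0#)
          ≈⟨ F.+-cong (combination-Mat s₀ g₀ _ (lookup-++ˡ {m = m} {n = n′} γ (extra zero) j)) (F.+-identityʳ _) ⟩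
        pairing s₀ (γ j) F.+ w₁ (j Fin.↑ˡ n′)
          ≈⟨ F.+-congʳ (pairing-γ s₀ j) ⟩
        v (j Fin.↑ˡ n′) F.- w₁ (j Fin.↑ˡ n′) F.+ w₁ (j Fin.↑ˡ n′)
          ≈⟨ GroupProperties.//-rightDividesˡ F.+-abelianGroup _ _ ⟩
        v (j Fin.↑ˡ n′) ∎)
      (λ j → begin
        w₀ (m Fin.↑ʳ j) F.+ (w₁ (m Fin.↑ʳ j) F.+ F.0#)
          ≈⟨ F.+-cong (combination-Mat s₀ g₀ _ (lookup-++ʳ {m = m} {n = n′} γ (extra zero) j)) (F.+-identityʳ _) ⟩
        pairing s₀ 0# F.+ w₁ (m Fin.↑ʳ j)
          ≈⟨ F.+-cong (pairing-0 s₀) (combination-Mat s₁ g₁ _ (lookup-++ʳ {m = m} {n = n′} (σ ∘ γ) (extra (suc zero)) j)) ⟩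
        F.0# F.+ pairing s₁ (γ (Fin.inject≤ j n′≤m))
          ≈⟨ F.+-identityˡ _ ⟩
        pairing s₁ (γ (Fin.inject≤ j n′≤m))
          ≈⟨ pairing-γ s₁ _ ⟩
        s₁ (Fin.inject≤ j n′≤m)
          ≡⟨ padRight-inject≤ n′≤m F.0# (λ j → v (m Fin.↑ʳ j)) j ⟩
        v (m Fin.↑ʳ j) ∎)
    where
    open ≈-Reasoning F.setoid
    row : Fin (2 ℕ.+ k) → ∃ (LE.Span generator)
    row i = generator i , LEP.generator∈span generator i
    g₀ = generator zero
    g₁ = generator (suc zero)
    s₀ s₁ : Vector F.Carrier m
    w₀ w₁ : Vector F.Carrier n
    -- Of the two generators only the second reaches the last `n′` entries, so `s₁` copies them from
    -- `v`, with zeros as padding. `s₀` then corrects the first `m` entries for what `w₁`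
    -- contributes there.
    s₁ = padRight n′≤m F.0# (λ j → v (m Fin.↑ʳ j))
    w₁ = LF.combination s₁ (Mat g₁)
    s₀ j = v (j Fin.↑ˡ n′) F.- w₁ (j Fin.↑ˡ n′)
    w₀ = LF.combination s₀ (Mat g₀)

open import Data.Nat using (_+_; _*_; _∸_)

theorem4p4 : ∀ {c₁ ℓ₁ c₂ ℓ₂} (q m k : ℕ) → IsPrimePower q →
    2 ≤ k → k ≤ (m + 1) / 2 →
    (X : FiniteFieldExtension q m c₁ ℓ₁ c₂ ℓ₂) (Γ : FiniteFieldExtension.Basis X) →
    (n : ℕ) → m ≤ n → n ≤ 2 * m ∸ 2 * k + 1 →
    ∃[ d ] Σ[ 𝒞 ∈ RankMetric.Code X Γ n k d ]
    RankMetric.Nondegenerate X Γ 𝒞 × RankMetric.Intersecting X Γ 𝒞 × n < 2 * d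
theorem4p4 q m (suc zero) _ (s≤s ())
theorem4p4 q m (suc (suc k)) (p , e , p-prime , _ , q≡p^e) 2≤k k≤ X Γ n m≤n n≤
  -- Splitting a word into leading and added entries requires its length to be literally of the form
  -- `m + n′`.
  with n ∸ m | ℕₚ.m+[n∸m]≡n m≤n
... | n′ | ≡.refl = _ , code , nondegenerate , intersecting , n<2d
  where
  bounds = length-bounds 2≤k k≤ m≤n n≤
  open ExtendedGabidulin X p e p-prime q≡p^e Γ k n′
    (extension-bound {m} {suc k} (proj₂ bounds)) (proj₁ bounds) (proj₂ bounds)
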